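{- Let $(\mathbf{S},\mathcal{E})$ be a finite information structure, $\alpha>0$, $n\in\mathbb{N}$, and let $\psi$ be a combinatorial $n$-cocycle. Suppose that, for all $X_1,\dots,X_n\in\operatorname{Ob}\mathbf{S}$ such that $X_1\cdots X_n\in\operatorname{Ob}\mathbf{S}$, there exists a measurable function $\phi[X_1|\dots|X_n]:\mathcal{P}_{X_1\cdots X_n}\to\mathbb{R}$ with the following property: for every $p\in\mathcal{P}_{X_1\cdots X_n}$ and every sequence of counting functions $\{\nu_m\}_{m\geq1}\subset\mathcal{C}_{X_1\cdots X_n}$ such that (1) $\|\nu_m\|\to\infty$ as $m\to\infty$, and (2) for every $z\in E_{X_1\cdots X_n}$, $\nu_m(z)/\|\nu_m\|\to p(z)$ as $m\to\infty$, the asymptotic formula $$\psi[X_1|\dots|X_n](\nu_m)=\exp\big(\|\nu_m\|^\alpha\,\phi[X_1|\dots|X_n](p)+o(\|\nu_m\|^\alpha)\big)$$ holds. Then $\phi$ is a probabilistic $n$-cocycle of type $\alpha$, i.e. $\phi\in Z^n(\mathbf{S},\mathcal{F}_\alpha)$.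
   Context: $\mathbb{N}=\{0,1,2,\dots\}$ and $\mathbb{R}_+^*=\{x\in\mathbb{R}: x>0\}$. A finite information structure is a pair $(\mathbf{S},\mathcal{E})$. Here $\mathbf{S}$ is a small category that is a poset (at most one arrow between any two objects, and $A\to B$, $B\to A$ imply $A=B$), has a terminal object $\mathbf{1}$, and is such that whenever there is a diagram $X\leftarrow Z\to Y$ the categorical product $X\wedge Y$ exists (written $XY$; products of several objects are iterated, and the empty product is $\mathbf{1}$). $\mathcal{E}$ is a functor from $\mathbf{S}$ to finite sets and surjections, $X\mapsto E_X$, which does not send nonidentity arrows to isomorphisms, such that $E_{\mathbf{1}}$ is a singleton and, whenever $XY$ exists, the map $E_{XY}\to E_X\times E_Y$ induced by the two projections is injective. "$X_1\cdots X_n\in\operatorname{Ob}\mathbf{S}$" means that this product exists in $\mathbf{S}$. Put $\mathcal{S}_X=\{Y\in\operatorname{Ob}\mathbf{S}:X\to Y\}$. Counting functions: $\mathcal{C}_X=\{\nu:E_X\to\mathbb{N} : \sum_{x}\nu(x)>0\}$, $\|\nu\|=\sum_x\nu(x)$. For $\pi:X\to Y$ and $\nu\in\mathcal{C}_X$, $Y_*\nu(y)=\sum_{x\in\mathcal{E}\pi^{ -1}(y)}\nu(x)$; if $Y_*\nu(y)\neq0$, $\nu|_{Y=y}$ equals $\nu$ on $\mathcal{E}\pi^{ -1}(y)$ and $0$ elsewhere. $\mathcal{G}_X$ is the multiplicative group of (measurable) functions $\mathcal{C}_X\to\mathbb{R}_+^*$, with $(Y.g)(\nu)=\prod_{y\in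 E_Y,\,Y_*\nu(y)\neq0}g(\nu|_{Y=y})$ for $Y\in\mathcal{S}_X$. Probabilities: $\mathcal{P}_X=\{p:E_X\to[0,1]:\sum_xp(x)=1\}$ (a standard simplex with its Borel $\sigma$-algebra), $Y_*p(y)=\sum_{x\in\mathcal{E}\pi^{ -1}(y)}p(x)$, and, if $Y_*p(y)\neq0$, $p|_{Y=y}(x)=p(x)/Y_*p(y)$ for $x\in\mathcal{E}\pi^{ -1}(y)$ and $0$ otherwise. $\mathcal{F}_\alpha(X)$ is the additive group of measurable functions $\mathcal{P}_X\to\mathbb{R}$ with $(Y.f)(p)=\sum_{y\in E_Y,\,Y_*p(y)\neq0}(Y_*p(y))^\alpha f(p|_{Y=y})$ for $Y\in\mathcal{S}_X$. Cochains: for $\mathcal{M}=\mathcal{G}$ or $\mathcal{M}=\mathcal{F}_\alpha$, an $n$-cochain is a family of elements $\phi_X[X_1|\dots|X_n]\in\mathcal{M}_X$, for $X\in\operatorname{Ob}\mathbf{S}$ and $X_1,\dots,X_n\in\mathcal{S}_X$, such that for every arrow $X\to Y$ with $X_1,\dots,X_n\in\mathcal{S}_Y$, $\phi_X[X_1|\dots|X_n](\cdot)=\phi_Y[X_1|\dots|X_n](Y_*\,\cdot)$. It is equivalently given by the functions $\phi[X_1|\dots|X_n]:=\phi_{X_1\cdots X_n}[X_1|\dots|X_n]$ on $\mathcal{C}_{X_1\cdots X_n}$ (resp. $\mathcal{P}_{X_1\cdots X_n}$), for all tuples whose product exists. An $n$-cochain $\phi$ of $\mathcal{F}_\alpha$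 is an $n$-cocycle (of type $\alpha$), $\phi\in Z^n(\mathbf{S},\mathcal{F}_\alpha)$, if for all $X$ and $X_1,\dots,X_{n+1}\in\mathcal{S}_X$, $$X_1.\phi_X[X_2|\dots|X_{n+1}]+\sum_{k=1}^n(-1)^k\phi_X[X_1|\dots|X_kX_{k+1}|\dots|X_{n+1}]+(-1)^{n+1}\phi_X[X_1|\dots|X_n]=0.$$ A combinatorial $n$-cocycle is an $n$-cochain $\psi$ of $\mathcal{G}$ satisfying the same condition written multiplicatively: for all $X$ and $X_1,\dots,X_{n+1}\in\mathcal{S}_X$, $$\big(X_1.\psi_X[X_2|\dots|X_{n+1}]\big)\prod_{k=1}^n\big(\psi_X[X_1|\dots|X_kX_{k+1}|\dots|X_{n+1}]\big)^{(-1)^k}\big(\psi_X[X_1|\dots|X_n]\big)^{(-1)^{n+1}}=1.$$ -}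

module Defs where

open import Algebra.Bundles using (CommutativeMonoid; AbelianGroup; CommutativeRing)
open import Axiom.ExcludedMiddle using (ExcludedMiddle)
open import Data.Bool.Base using (if_then_else_; true; false)
open import Data.Fin.Base using (Fin; zero; suc; toℕ; punchIn)
open import Data.Fin.Properties using (inj⇒≟; punchInᵢ≢i)
open import Data.Nat.Base as ℕ using (ℕ; zero; suc)
import Data.Nat.Properties as ℕₚ
open import Data.Product.Base using (∃; _×_; _,_; proj₁; proj₂)
open import Data.Sum.Base using (inj₁; inj₂)
open import Data.Vec.Base as Vec using (Vec; []; _∷_)
import Data.Vec.Functional as Vector
open import Function.Base using (_∘_; case_of_)
open import Function.Bundles using (_↔_; Inverse)
open import Function.Definitions using (Surjective; Bijective)
open import Function.Properties.Inverse using (↔⇒↣)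
open import Level using (Level; 0ℓ) renaming (suc to lsuc)
open import Relation.Binary.Core using (Rel)
open import Relation.Binary.Definitions using (Irrelevant; DecidableEquality; tri<; tri≈; tri>)
open import Relation.Binary.PropositionalEquality as ≡ using (_≡_; _≢_; _≗_; refl)
open import Relation.Binary.Structures using (IsPartialOrder; IsStrictTotalOrder)
open import Relation.Nullary.Decidable using (yes; no; does; dec-true; dec-false)
open import Relation.Nullary.Negation.Core using (¬_; contradiction)
open import Relation.Unary using (Pred; _≐_; ∁; ⋃)

import Algebra.Definitions.RawMonoid as RawMonoidDefinitions
import Algebra.Properties.CommutativeMonoid.Sum as MonoidSum
import Algebra.Properties.Group as GroupProperties
import Algebra.Properties.Ring as RingProperties
import Algebra.Properties.Semiring.Exp as SemiringExp
import Algebra.Properties.Semiring.Sum as SemiringSum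
import Relation.Binary.Construct.StrictToNonStrict as StrictToNonStrict

-- Universal property of the categorical product in a category with at most
-- one arrow between two objects: uniqueness of the mediating arrow and
-- commutation with the projections are automatic.
record IsProduct {Ob : Set} (_⟶_ : Rel Ob 0ℓ) (X Y P : Ob) : Set where
  field
    π₁    : P ⟶ X
    π₂    : P ⟶ Y
    ⟨_,_⟩ : ∀ {Q} → Q ⟶ X → Q ⟶ Y → Q ⟶ P

record InformationStructure : Set₁ where
  infix 4 _⟶_
  field
    Ob             : Set
    _⟶_            : Rel Ob 0ℓ
    isPartialOrder : IsPartialOrder _≡_ _⟶_
    irrelevant     : Irrelevant _⟶_

  open IsPartialOrder isPartialOrder public
    using () renaming (refl to id⟶; trans to _⨾_)

  field
    𝟏       : Ob
    !       : ∀ {X} → X ⟶ 𝟏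
    product : ∀ {X Y Z} → Z ⟶ X → Z ⟶ Y → ∃ (IsProduct _⟶_ X Y)

    E               : Ob → Set
    finite          : ∀ X → ∃ λ k → E X ↔ Fin k
    E₁              : ∀ {X Y} → X ⟶ Y → E X → E Y
    E₁-id           : ∀ {X} (x : E X) → E₁ id⟶ x ≡ x
    E₁-⨾            : ∀ {X Y Z} (π : X ⟶ Y) (ρ : Y ⟶ Z) (x : E X) →
                      E₁ (π ⨾ ρ) x ≡ E₁ ρ (E₁ π x)
    E₁-surjective   : ∀ {X Y} (π : X ⟶ Y) → Surjective _≡_ _≡_ (E₁ π)
    -- X ⟶ Y is an identity exactly when X ≡ Y.
    E₁-conservative : ∀ {X Y} (π : X ⟶ Y) → Bijective _≡_ _≡_ (E₁ π) → X ≡ Y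
    E-𝟏             : ∃ λ (∗ : E 𝟏) → ∀ e → e ≡ ∗
    E-product       : ∀ {X Y P} (prod : IsProduct _⟶_ X Y P) {z z′ : E P} →
                      let open IsProduct prod in
                      E₁ π₁ z ≡ E₁ π₁ z′ → E₁ π₂ z ≡ E₁ π₂ z′ → z ≡ z′

  -- IsProductOf (X₁ ∷ … ∷ Xₙ ∷ []) P : the product X₁⋯Xₙ exists and is P.
  data IsProductOf : ∀ {n} → Vec Ob n → Ob → Set where
    []  : IsProductOf [] 𝟏
    _∷_ : ∀ {n X P Q} {Xs : Vec Ob n} →
          IsProduct _⟶_ X Q P → IsProductOf Xs Q → IsProductOf (X ∷ Xs) P

  𝒮 : Ob → Set
  𝒮 X = ∃ λ Y → X ⟶ Y

  precompose : ∀ {X Y} → X ⟶ Y → 𝒮 Y → 𝒮 X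
  precompose π (Z , ρ) = Z , π ⨾ ρ

  factors : ∀ {n P} {Xs : Vec Ob n} → IsProductOf Xs P → Vec (𝒮 P) n
  factors []            = []
  factors (prod ∷ rest) =
    (_ , IsProduct.π₁ prod) ∷
    Vec.map (precompose (IsProduct.π₂ prod)) (factors rest)

  _⋀_ : ∀ {X} → 𝒮 X → 𝒮 X → 𝒮 X
  (_ , π) ⋀ (_ , ρ) with product π ρ
  ... | P , prod = P , IsProduct.⟨_,_⟩ prod π ρ

  -- merge k : [X₁|…|Xₙ₊₁] ↦ [X₁|…|Xₖ₊₁Xₖ₊₂|…|Xₙ₊₁], with k counted from 0.
  merge : ∀ {X n} → Fin n → Vec (𝒮 X) (suc n) → Vec (𝒮 X) n
  merge zero    (Y ∷ Z ∷ Xs) = (Y ⋀ Z) ∷ Xs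
  merge (suc k) (Y ∷ Xs)     = Y ∷ merge k Xs

  infix 4 _≟ᴱ_
  _≟ᴱ_ : ∀ {X} → DecidableEquality (E X)
  _≟ᴱ_ {X} = inj⇒≟ (↔⇒↣ (proj₂ (finite X)))

module Summation (𝐒 : InformationStructure) (M : CommutativeMonoid 0ℓ 0ℓ) where
  open InformationStructure 𝐒
  open CommutativeMonoid M
    renaming (Carrier to A; refl to ≈-refl; trans to ≈-trans; sym to ≈-sym)
  open MonoidSum M using (sum; sum-remove; sum-cong-≋; sum-replicate-zero; ∑-comm)

  enumerate : ∀ X → Fin (proj₁ (finite X)) → E X
  enumerate X = Inverse.from (proj₂ (finite X))

  ∑ : ∀ X → (E X → A) → A
  ∑ X f = sum (f ∘ enumerate X)

  onFibre : ∀ {X Y} → X ⟶ Y → (E X → A) → E Y → (E X → A)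
  onFibre π f y x = if does (E₁ π x ≟ᴱ y) then f x else ε

  marginal : ∀ {X Y} → X ⟶ Y → (E X → A) → (E Y → A)
  marginal {X} π f y = ∑ X (onFibre π f y)

  onFibre-∈ : ∀ {X Y} (π : X ⟶ Y) (f : E X → A) {x y} →
              E₁ π x ≡ y → onFibre π f y x ≡ f x
  onFibre-∈ π f {x} {y} eq =
    ≡.cong (if_then f x else ε) (dec-true (E₁ π x ≟ᴱ y) eq)

  onFibre-∉ : ∀ {X Y} (π : X ⟶ Y) (f : E X → A) {x y} →
              E₁ π x ≢ y → onFibre π f y x ≡ ε
  onFibre-∉ π f {x} {y} ne =
    ≡.cong (if_then f x else ε) (dec-false (E₁ π x ≟ᴱ y) ne)

  ∑-cong : ∀ X {f g : E X → A} → (∀ x → f x ≈ g x) → ∑ X f ≈ ∑ X g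
  ∑-cong X {f} {g} f≈g = sum-cong-≋ {x = f ∘ enumerate X} {g ∘ enumerate X}
    (λ i → f≈g (enumerate X i))

  private
    sum-single : ∀ {n} (t : Vector.Vector A n) i →
                 (∀ j → j ≢ i → t j ≈ ε) → sum t ≈ t i
    sum-single {suc n} t i zeros =
      ≈-trans (sum-remove {i = i} t) (≈-trans (∙-congˡ rest) (identityʳ _))
      where
      rest : sum (Vector.removeAt t i) ≈ ε
      rest = ≈-trans (sum-cong-≋ (λ j → zeros (punchIn i j) (punchInᵢ≢i i j)))
                     (sum-replicate-zero n)

    ∑-onFibre : ∀ {X Y} (π : X ⟶ Y) (f : E X → A) x →
                ∑ Y (λ y → onFibre π f y x) ≈ f x
    ∑-onFibre {X} {Y} π f x = ≈-trans (sum-single _ i off) on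
      where
      open Inverse (proj₂ (finite Y)) using (to; from; strictlyInverseˡ; strictlyInverseʳ)
      i = to (E₁ π x)
      off : ∀ j → j ≢ i → onFibre π f (from j) x ≈ ε
      off j j≢i = reflexive (onFibre-∉ π f λ eq →
        j≢i (≡.trans (≡.sym (strictlyInverseˡ j)) (≡.cong to (≡.sym eq))))
      on : onFibre π f (from i) x ≈ f x
      on = reflexive (onFibre-∈ π f (≡.sym (strictlyInverseʳ (E₁ π x))))

  ∑-marginal : ∀ {X Y} (π : X ⟶ Y) (f : E X → A) →
               ∑ Y (marginal π f) ≈ ∑ X f
  ∑-marginal {X} {Y} π f =
    ≈-trans (∑-comm (λ j i → onFibre π f (enumerate Y j) (enumerate X i)))
            (∑-cong X (∑-onFibre π f))

-- ℝ is, up to unique isomorphism, the Dedekind-complete ordered field.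
-- Equality is a setoid equality, as for Cauchy sequences or Dedekind cuts.
record CompleteOrderedField : Set₁ where
  field
    commutativeRing : CommutativeRing 0ℓ 0ℓ
  open CommutativeRing commutativeRing public
    renaming ( Carrier to ℝ; refl to ≈-refl; sym to ≈-sym; trans to ≈-trans
             ; zero to *-zero )

  infix 4 _<_
  field
    _<_                : Rel ℝ 0ℓ
    isStrictTotalOrder : IsStrictTotalOrder _≈_ _<_
    inverse            : ∀ x → ¬ x ≈ 0# → ∃ λ y → x * y ≈ 1#
    0<1                : 0# < 1#
    +-monoˡ-<          : ∀ {x y} z → x < y → x + z < y + z
    *-positive         : ∀ {x y} → 0# < x → 0# < y → 0# < x * y

  open IsStrictTotalOrder isStrictTotalOrder public
    using (compare; _≟_; <-respʳ-≈; <-respˡ-≈)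
    renaming (trans to <-trans; irrefl to <-irrefl; asym to <-asym)
  open StrictToNonStrict _≈_ _<_ public using (_≤_)

  _IsUpperBoundOf_ : ℝ → Pred ℝ 0ℓ → Set
  b IsUpperBoundOf P = ∀ x → P x → x ≤ b

  field
    supremum : ∀ (P : Pred ℝ 0ℓ) → ∃ P → ∃ (_IsUpperBoundOf P) →
               ∃ λ s → s IsUpperBoundOf P × (∀ b → b IsUpperBoundOf P → s ≤ b)

module Real (em : ExcludedMiddle 0ℓ) (𝐑 : CompleteOrderedField) where
  open CompleteOrderedField 𝐑 public
  open SemiringExp semiring public using (_^_)
  open RawMonoidDefinitions +-rawMonoid using () renaming (_×_ to _·_)
  open RingProperties ring using (-‿distribʳ-*)

  fromℕ : ℕ → ℝ
  fromℕ n = n · 1#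

  -- Total division, with the junk value 0⁻¹ = 0.
  infix  8 _⁻¹
  infixl 7 _/_

  _⁻¹ : ℝ → ℝ
  x ⁻¹ with x ≟ 0#
  ... | yes _   = 0#
  ... | no  x≉0 = proj₁ (inverse x x≉0)

  _/_ : ℝ → ℝ → ℝ
  x / y = x * y ⁻¹

  -- Equivalent to ∣ x − y ∣ < ε.
  Close : ℝ → ℝ → ℝ → Set
  Close ε x y = (x < y + ε) × (y < x + ε)

  infix 4 _⇝_
  _⇝_ : (ℕ → ℝ) → ℝ → Set
  s ⇝ l = ∀ ε → 0# < ε → ∃ λ N → ∀ n → N ℕ.≤ n → Close ε (s n) l

  -- Junk value 0 for divergent sequences.
  lim : (ℕ → ℝ) → ℝ
  lim s = case em {∃ (s ⇝_)} of λ where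
    (yes (l , _)) → l
    (no  _)       → 0#

  exp : ℝ → ℝ
  exp x = lim λ n → (1# + x / fromℕ (suc n)) ^ suc n

  -- Junk value 0 outside the range of exp, that is, for y ≤ 0.
  ln : ℝ → ℝ
  ln y = case em {∃ λ x → exp x ≈ y} of λ where
    (yes (x , _)) → x
    (no  _)       → 0#

  -- t to the real power a, meaningful for t > 0 only.
  infixr 8 _^ᴿ_
  _^ᴿ_ : ℝ → ℝ → ℝ
  t ^ᴿ a = exp (a * ln t)

  -- r = o(g), for a nowhere vanishing g.
  infix 4 _∈o_
  _∈o_ : (ℕ → ℝ) → (ℕ → ℝ) → Set
  r ∈o g = (λ m → r m / g m) ⇝ 0#

  module Borel {A : Set} (Near : ℝ → A → A → Set) where

    Open : Pred A 0ℓ → Set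
    Open U = ∀ x → U x → ∃ λ ε → 0# < ε × (∀ y → Near ε x y → U y)

    data IsBorel : Pred A 0ℓ → Set₁ where
      isOpen     : ∀ {U} → Open U → IsBorel U
      complement : ∀ {U} → IsBorel U → IsBorel (∁ U)
      union      : ∀ {U : ℕ → Pred A 0ℓ} → (∀ i → IsBorel (U i)) → IsBorel (⋃ ℕ U)
      resp       : ∀ {U V} → U ≐ V → IsBorel U → IsBorel V

  ⁻¹-inverseʳ : ∀ {x} → ¬ x ≈ 0# → x * x ⁻¹ ≈ 1#
  ⁻¹-inverseʳ {x} x≉0 with x ≟ 0#
  ... | yes x≈0 = contradiction x≈0 x≉0
  ... | no  h   = proj₂ (inverse x h)

  positive⇒≉0 : ∀ {x} → 0# < x → ¬ x ≈ 0#
  positive⇒≉0 0<x x≈0 = <-irrefl (≈-sym x≈0) 0<x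

  negative⇒-positive : ∀ {x} → x < 0# → 0# < - x
  negative⇒-positive {x} x<0 =
    <-respʳ-≈ (+-identityˡ _) (<-respˡ-≈ (-‿inverseʳ x) (+-monoˡ-< (- x) x<0))

  ⁻¹-positive : ∀ {x} → 0# < x → 0# < x ⁻¹
  ⁻¹-positive {x} 0<x with compare (x ⁻¹) 0#
  ... | tri> _ _ 0<y = 0<y
  ... | tri≈ _ y≈0 _ = contradiction 0<1 (<-irrefl
          (≈-trans (≈-sym (zeroʳ x)) (≈-trans (*-congˡ (≈-sym y≈0)) (⁻¹-inverseʳ (positive⇒≉0 0<x)))))
  ... | tri< y<0 _ _ = contradiction 1<0 (<-asym 0<1)
    where
    0<-1 : 0# < - 1#
    0<-1 = <-respʳ-≈
      (≈-trans (≈-sym (-‿distribʳ-* x (x ⁻¹))) (-‿cong (⁻¹-inverseʳ (positive⇒≉0 0<x))))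
      (*-positive 0<x (negative⇒-positive y<0))
    1<0 : 1# < 0#
    1<0 = <-respʳ-≈ (-‿inverseˡ 1#) (<-respˡ-≈ (+-identityˡ 1#) (+-monoˡ-< 1# 0<-1))

  ℝ₊* : AbelianGroup 0ℓ 0ℓ
  ℝ₊* = record
    { Carrier = ∃ (0# <_)
    ; _≈_     = λ x y → proj₁ x ≈ proj₁ y
    ; _∙_     = λ (x , 0<x) (y , 0<y) → x * y , *-positive 0<x 0<y
    ; ε       = 1# , 0<1
    ; _⁻¹     = λ (x , 0<x) → x ⁻¹ , ⁻¹-positive 0<x
    ; isAbelianGroup = record
      { isGroup = record
        { isMonoid = record
          { isSemigroup = record
            { isMagma = record
              { isEquivalence = record { refl = ≈-refl ; sym = ≈-sym ; trans = ≈-trans }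
              ; ∙-cong        = *-cong
              }
            ; assoc = λ x y z → *-assoc (proj₁ x) (proj₁ y) (proj₁ z)
            }
          ; identity = (λ x → *-identityˡ (proj₁ x)) , (λ x → *-identityʳ (proj₁ x))
          }
        ; inverse = (λ (x , 0<x) → inverseˡ 0<x) , (λ (x , 0<x) → inverseʳ 0<x)
        ; ⁻¹-cong = λ {(x , 0<x)} {(y , 0<y)} x≈y → unique 0<x 0<y x≈y
        }
      ; comm = λ x y → *-comm (proj₁ x) (proj₁ y)
      }
    }
    where
    inverseʳ : ∀ {x} → 0# < x → x * x ⁻¹ ≈ 1#
    inverseʳ 0<x = ⁻¹-inverseʳ (positive⇒≉0 0<x)
    inverseˡ : ∀ {x} → 0# < x → x ⁻¹ * x ≈ 1#
    inverseˡ 0<x = ≈-trans (*-comm _ _) (inverseʳ 0<x)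
    unique : ∀ {x y} → 0# < x → 0# < y → x ≈ y → x ⁻¹ ≈ y ⁻¹
    unique {x} {y} 0<x 0<y x≈y =
      ≈-trans (≈-sym (*-identityʳ _)) (≈-trans (*-congˡ (≈-sym (inverseʳ 0<y)))
      (≈-trans (≈-sym (*-assoc _ _ _)) (≈-trans
        (*-congʳ (≈-trans (*-congˡ (≈-sym x≈y)) (inverseˡ 0<x))) (*-identityˡ _))))

module Cohomology
  (em : ExcludedMiddle 0ℓ) (𝐑 : CompleteOrderedField) (𝐒 : InformationStructure)
  where
  open Real em 𝐑 public
  open InformationStructure 𝐒 public

  module Σℕ = Summation 𝐒 ℕₚ.+-0-commutativeMonoid
  module Σℝ = Summation 𝐒 +-commutativeMonoid
  module Πℝ = Summation 𝐒 (AbelianGroup.commutativeMonoid ℝ₊*)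

  -- Families of groups of functions X ↦ { f : Point X → Value | Element X f },
  -- with the pushforward Y_* of points and the action f ↦ Y.f.
  record Coefficients (ℓ : Level) : Set (lsuc 0ℓ Level.⊔ lsuc ℓ) where
    field
      Value   : AbelianGroup 0ℓ 0ℓ
      Point   : Ob → Set
      push    : ∀ {X Y} → X ⟶ Y → Point X → Point Y
    open AbelianGroup Value public
      using (_∙_; ε) renaming (Carrier to V; _≈_ to _≈ⱽ_; _⁻¹ to invert)
    open MonoidSum (AbelianGroup.commutativeMonoid Value) public using (sum)
    field
      Element : ∀ X → (Point X → V) → Set ℓ
      act     : ∀ {X Y} → X ⟶ Y → (Point X → V) → (Point X → V)

    -- signed k v is (-1)ᵏ v, or v to the power (-1)ᵏ multiplicatively.
    signed : ℕ → V → V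
    signed zero    v = v
    signed (suc k) v = invert (signed k v)

  record Cochain {ℓ} (M : Coefficients ℓ) (n : ℕ) : Set ℓ where
    open Coefficients M
    field
      ⟦_⟧     : ∀ {X} → Vec (𝒮 X) n → Point X → V
      element : ∀ {X} (Xs : Vec (𝒮 X) n) → Element X ⟦ Xs ⟧
      natural : ∀ {X Y} (π : X ⟶ Y) (Xs : Vec (𝒮 Y) n) a →
                ⟦ Vec.map (precompose π) Xs ⟧ a ≈ⱽ ⟦ Xs ⟧ (push π a)

    -- φ[X₁|…|Xₙ], defined on the points of the product X₁⋯Xₙ
    reduced : ∀ {P} {Xs : Vec Ob n} → IsProductOf Xs P → Point P → V
    reduced prod = ⟦ factors prod ⟧

  IsCocycle : ∀ {ℓ} {M : Coefficients ℓ} {n} → Cochain M n → Set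
  IsCocycle {M = M} {n} φ =
    ∀ {X} (Xs : Vec (𝒮 X) (suc n)) (a : Point X) →
      ( act (proj₂ (Vec.head Xs)) ⟦ Vec.tail Xs ⟧ a
      ∙ sum (λ k → signed (suc (toℕ k)) (⟦ merge k Xs ⟧ a)) )
      ∙ signed (suc n) (⟦ Vec.init Xs ⟧ a)
      ≈ⱽ ε
    where
    open Coefficients M
    open Cochain φ

  record 𝒞 (X : Ob) : Set where
    constructor counting
    field
      count    : E X → ℕ
      positive : 0 ℕ.< Σℕ.∑ X count
  open 𝒞 public

  ∥_∥ : ∀ {X} → 𝒞 X → ℕ
  ∥_∥ {X} ν = Σℕ.∑ X (count ν)

  push-𝒞 : ∀ {X Y} → X ⟶ Y → 𝒞 X → 𝒞 Y
  push-𝒞 π ν = counting (Σℕ.marginal π (count ν))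
    (≡.subst (0 ℕ.<_) (≡.sym (Σℕ.∑-marginal π (count ν))) (positive ν))

  -- ν|_{Y=y}, whose total mass is Y_*ν(y)
  condition-𝒞 : ∀ {X Y} (π : X ⟶ Y) (ν : 𝒞 X) (y : E Y) →
                count (push-𝒞 π ν) y ≢ 0 → 𝒞 X
  condition-𝒞 π ν y ≢0 = counting (Σℕ.onFibre π (count ν) y) (ℕₚ.n≢0⇒n>0 ≢0)

  act-𝒢 : ∀ {X Y} → X ⟶ Y → (𝒞 X → ∃ (0# <_)) → (𝒞 X → ∃ (0# <_))
  act-𝒢 {X} {Y} π g ν = Πℝ.∑ Y λ y →
    case count (push-𝒞 π ν) y ℕₚ.≟ 0 of λ where
      (yes _)  → 1# , 0<1
      (no  ≢0) → g (condition-𝒞 π ν y ≢0)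

  -- 𝒞 X is countable and discrete, so measurability is no condition.
  𝒢 : Coefficients 0ℓ
  𝒢 = record
    { Value   = ℝ₊*
    ; Point   = 𝒞
    ; push    = push-𝒞
    ; Element = λ X g → ∀ {ν ν′} → count ν ≗ count ν′ → proj₁ (g ν) ≈ proj₁ (g ν′)
    ; act     = act-𝒢
    }

  -- The bound prob x ≤ 1 follows from the other two.
  record 𝒫 (X : Ob) : Set where
    constructor probability
    field
      prob        : E X → ℝ
      nonnegative : ∀ x → 0# ≤ prob x
      total       : Σℝ.∑ X prob ≈ 1#
  open 𝒫 public

  private
    +-nonnegative : ∀ {x y} → 0# ≤ x → 0# ≤ y → 0# ≤ x + y
    +-nonnegative {x} {y} (inj₂ 0≈x) (inj₂ 0≈y) =
      inj₂ (≈-trans (≈-sym (+-identityˡ 0#)) (+-cong 0≈x 0≈y))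
    +-nonnegative {x} {y} (inj₂ 0≈x) (inj₁ 0<y) =
      inj₁ (<-respʳ-≈ (≈-trans (≈-sym (+-identityˡ y)) (+-congʳ 0≈x)) 0<y)
    +-nonnegative {x} {y} (inj₁ 0<x) (inj₂ 0≈y) =
      inj₁ (<-respʳ-≈ (≈-trans (≈-sym (+-identityʳ x)) (+-congˡ 0≈y)) 0<x)
    +-nonnegative {x} {y} (inj₁ 0<x) (inj₁ 0<y) =
      inj₁ (<-trans 0<y (<-respˡ-≈ (+-identityˡ y) (+-monoˡ-< y 0<x)))

    open MonoidSum +-commutativeMonoid using () renaming (sum to sumℝ)

    sum-nonnegative : ∀ {n} (t : Fin n → ℝ) → (∀ i → 0# ≤ t i) → 0# ≤ sumℝ t
    sum-nonnegative {zero}  t 0≤t = inj₂ ≈-refl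
    sum-nonnegative {suc n} t 0≤t =
      +-nonnegative (0≤t zero) (sum-nonnegative (t ∘ suc) (0≤t ∘ suc))

    marginal-nonnegative : ∀ {X Y} (π : X ⟶ Y) (p : 𝒫 X) y →
                           0# ≤ Σℝ.marginal π (prob p) y
    marginal-nonnegative π p y = sum-nonnegative _ λ i → on (Inverse.from (proj₂ (finite _)) i)
      where
      on : ∀ x → 0# ≤ Σℝ.onFibre π (prob p) y x
      on x with does (E₁ π x ≟ᴱ y)
      ... | true  = nonnegative p x
      ... | false = inj₂ ≈-refl

  push-𝒫 : ∀ {X Y} → X ⟶ Y → 𝒫 X → 𝒫 Y
  push-𝒫 π p = probability (Σℝ.marginal π (prob p))
    (marginal-nonnegative π p) (≈-trans (Σℝ.∑-marginal π (prob p)) (total p))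

  condition-𝒫 : ∀ {X Y} (π : X ⟶ Y) (p : 𝒫 X) (y : E Y) →
                ¬ prob (push-𝒫 π p) y ≈ 0# → 𝒫 X
  condition-𝒫 {X} π p y ≉0 = probability conditional conditional-nonnegative
    (≈-trans (Σℝ.∑-cong X scaled) (≈-trans (≈-sym (*-distribʳ-sum s⁻¹ onFibre)) (⁻¹-inverseʳ ≉0)))
    where
    open SemiringSum semiring using (*-distribʳ-sum)
    s   = prob (push-𝒫 π p) y
    s⁻¹ = s ⁻¹

    onFibre = Σℝ.onFibre π (prob p) y ∘ Σℝ.enumerate X

    conditional : E X → ℝ
    conditional x = if does (E₁ π x ≟ᴱ y) then prob p x / s else 0#

    0<s : 0# < s
    0<s with marginal-nonnegative π p y
    ... | inj₁ 0<s = 0<s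
    ... | inj₂ 0≈s = contradiction (≈-sym 0≈s) ≉0

    conditional-nonnegative : ∀ x → 0# ≤ conditional x
    conditional-nonnegative x with does (E₁ π x ≟ᴱ y)
    ... | false = inj₂ ≈-refl
    ... | true with nonnegative p x
    ...   | inj₁ 0<px = inj₁ (*-positive 0<px (⁻¹-positive 0<s))
    ...   | inj₂ 0≈px = inj₂ (≈-trans (≈-sym (zeroˡ s⁻¹)) (*-congʳ 0≈px))

    scaled : ∀ x → conditional x ≈ Σℝ.onFibre π (prob p) y x * s⁻¹
    scaled x with does (E₁ π x ≟ᴱ y)
    ... | true  = ≈-refl
    ... | false = ≈-sym (zeroˡ s⁻¹)

  act-ℱ : ∀ {X Y} → ℝ → X ⟶ Y → (𝒫 X → ℝ) → (𝒫 X → ℝ)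
  act-ℱ {X} {Y} α π f p = Σℝ.∑ Y λ y →
    case prob (push-𝒫 π p) y ≟ 0# of λ where
      (yes _)  → 0#
      (no  ≉0) → prob (push-𝒫 π p) y ^ᴿ α * f (condition-𝒫 π p y ≉0)

  IsBorel-ℝ : Pred ℝ 0ℓ → Set₁
  IsBorel-ℝ = Borel.IsBorel Close

  -- Generated by the sup-norm topology, the subspace topology of 𝒫 X ⊆ ℝ^{E X}.
  IsBorel-𝒫 : ∀ X → Pred (𝒫 X) 0ℓ → Set₁
  IsBorel-𝒫 X = Borel.IsBorel λ ε p q → ∀ x → Close ε (prob p x) (prob q x)

  record IsMeasurable (X : Ob) (f : 𝒫 X → ℝ) : Set₁ where
    field
      cong       : ∀ {p q} → (∀ x → prob p x ≈ prob q x) → f p ≈ f q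
      measurable : ∀ {B} → IsBorel-ℝ B → IsBorel-𝒫 X (B ∘ f)

  ℱ : ℝ → Coefficients (lsuc 0ℓ)
  ℱ α = record
    { Value   = +-abelianGroup
    ; Point   = 𝒫
    ; push    = push-𝒫
    ; Element = IsMeasurable
    ; act     = act-ℱ α
    }

  -- Membership in Zⁿ(𝐒, ℱ α) of a family given in the reduced form φ[X₁|…|Xₙ].
  IsProbabilisticCocycle :
    ∀ (α : ℝ) (n : ℕ) →
    (∀ (Xs : Vec Ob n) {P} → IsProductOf Xs P → 𝒫 P → ℝ) → Set₁
  IsProbabilisticCocycle α n φ =
    ∃ λ (Φ : Cochain (ℱ α) n) →
      IsCocycle Φ ×
      (∀ (Xs : Vec Ob n) {P} (prod : IsProductOf Xs P) p →
         Cochain.reduced Φ prod p ≈ φ Xs prod p)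

{-# OPTIONS --safe #-}
module Submission where

open import Algebra.Bundles using (AbelianGroup; CommutativeRing)
open import Algebra.Solver.Ring.AlmostCommutativeRing using (fromCommutativeRing; _-Raw-AlmostCommutative⟶_)
open import Axiom.ExcludedMiddle using (ExcludedMiddle)
open import Data.Bool.Base using (true; false)
open import Data.Fin.Base using (Fin; zero; suc; toℕ)
open import Data.Integer.Base as ℤ using (ℤ; +_; -[1+_]; 0ℤ; 1ℤ)
open import Data.Nat.Base as ℕ using (ℕ; zero; suc)
open import Data.Product.Base using (∃; _×_; _,_; proj₁; proj₂)
open import Data.Sum.Base using (_⊎_; inj₁; inj₂)
open import Data.Vec.Base as Vec using (Vec; []; _∷_)
open import Function.Base using (_∘_)
open import Function.Bundles using (Inverse)
open import Level using (0ℓ)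
open import Relation.Binary.Bundles using (StrictPartialOrder)
open import Relation.Binary.Definitions using (tri<; tri≈; tri>)
open import Relation.Binary.PropositionalEquality as ≡ using (_≡_; _≢_)
open import Relation.Binary.Structures using (IsStrictTotalOrder)
open import Relation.Nullary.Decidable using (yes; no; does; dec⇒maybe)
open import Relation.Nullary.Negation.Core using (¬_; contradiction)
open import Relation.Unary using (Pred)
open import Defs

import Algebra.Properties.AbelianGroup as AbelianGroupProperties
import Algebra.Properties.CommutativeMonoid.Sum as MonoidSum
import Algebra.Properties.CommutativeSemiring.Exp as CommutativeSemiringExp
import Algebra.Properties.Ring as RingProperties
import Algebra.Properties.Semiring.Mult.TCOptimised as Mult
import Algebra.Properties.Semiring.Sum as SemiringSum
import Algebra.Solver.Ring
import Data.Integer.Properties as ℤₚ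
import Data.Maybe.Base as Maybe
import Data.Nat.Properties as ℕₚ
import Relation.Binary.Construct.StrictToNonStrict as StrictToNonStrict
import Relation.Binary.Reasoning.Setoid as SetoidReasoning
import Relation.Binary.Reasoning.StrictPartialOrder as StrictReasoning

-- A relation ψ(νₘ) = exp(‖νₘ‖^α l + o(‖νₘ‖^α)) along every sequence νₘ tending to p determines l, because
-- such sequences exist: take νₘ = ⌈(m + 1) p⌉. Hence the limit φ inherits from ψ the independence of the
-- chosen product and the naturality, and the cocycle identity of ψ at νₘ becomes that of φ at p once each
-- factor is known to have a limit. Only the action needs care: νₘ vanishes exactly where p does, so the
-- product over y has the same support as the sum for p. For y in this support, νₘ|_{Y=y} tends to p|_{Y=y}
-- and its mass is asymptotic to Y_*p(y) ‖νₘ‖, which produces the weight (Y_*p(y))^α.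
--
-- The functional equation of exp comes from Bernoulli's inequality: x + y + z = 0 gives
-- exp x exp y exp z ≥ 1, also for the negatives, and exp x exp (- x) ≤ 1.

-- The hypothesis supplies one function for each witness that an object is `X₁⋯Xₙ`. It asserts no
-- compatibility between witnesses and gives no value at an object that merely maps to the product,
-- whereas a cochain is indexed by every `X` and every tuple in `𝒮 X`. So `φ` is pulled back along
-- `X ⟶ X₁⋯Xₙ`, and each required identity is obtained by recognising both sides as limits attached
-- to one and the same function built from `ψ`. The choice of sequence is dictated by fibres with
-- Y_*p(y) = 0. A sequence tending to `p` may still put a few counts there; the action on `ψ` then
-- has a factor evaluated at counting functions whose mass may stay bounded or whose frequencies may
-- not converge, and nothing is assumed about those. Ceilings exclude such factors for every m, and
-- they bound the mass of every other fibre below by a linear function of m, so that the hypothesis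
-- applies to the conditioned sequences too.

module IntegerCoefficients {c ℓ} (R : CommutativeRing c ℓ) where
  open CommutativeRing R
  open Mult semiring using (×1-homo-*; ×-homo-+) renaming (_×_ to _·_)
  open AbelianGroupProperties +-abelianGroup
    using (⁻¹-involutive; ε⁻¹≈ε; ⁻¹-∙-comm)
  open RingProperties ring using (-‿distribˡ-*; -‿distribʳ-*)
  open SetoidReasoning setoid

  -- The optimised multiple reduces `1 · 1#` to `1#`, so `con 0ℤ` and `con 1ℤ` denote `0#` and `1#`
  -- definitionally in solver equations.
  ⟦_⟧ : ℤ → Carrier
  ⟦ + n ⟧      = n · 1#
  ⟦ -[1+ n ] ⟧ = - (suc n · 1#)

  suc-· : ∀ n → suc n · 1# ≈ 1# + n · 1#
  suc-· = ×-homo-+ 1# 1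

  -- Integer addition with mixed signs is a difference of naturals; removing a successor from both
  -- sides leaves a cancelling `1# - 1#`.
  ⟦⟧-⊖ : ∀ m n → ⟦ m ℤ.⊖ n ⟧ ≈ m · 1# - n · 1#
  ⟦⟧-⊖ m zero = begin
    ⟦ m ℤ.⊖ 0 ⟧    ≡⟨ ≡.cong ⟦_⟧ (ℤₚ.⊖-≥ (ℕ.z≤n {m})) ⟩
    m · 1#         ≈⟨ +-identityʳ _ ⟨
    m · 1# + 0#    ≈⟨ +-congˡ ε⁻¹≈ε ⟨
    m · 1# - 0#    ∎
  ⟦⟧-⊖ zero (suc n) = sym (+-identityˡ _)
  ⟦⟧-⊖ (suc m) (suc n) = begin
    ⟦ suc m ℤ.⊖ suc n ⟧             ≡⟨ ≡.cong ⟦_⟧ (ℤₚ.[1+m]⊖[1+n]≡m⊖n m n) ⟩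
    ⟦ m ℤ.⊖ n ⟧                     ≈⟨ ⟦⟧-⊖ m n ⟩
    m · 1# - n · 1#                 ≈⟨ +-identityˡ _ ⟨
    0# + (m · 1# - n · 1#)          ≈⟨ +-congʳ (-‿inverseʳ 1#) ⟨
    (1# - 1#) + (m · 1# - n · 1#)   ≈⟨ +-assoc 1# (- 1#) _ ⟩
    1# + (- 1# + (m · 1# - n · 1#)) ≈⟨ +-congˡ (+-assoc (- 1#) _ _) ⟨
    1# + ((- 1# + m · 1#) - n · 1#) ≈⟨ +-congˡ (+-congʳ (+-comm (- 1#) _)) ⟩
    1# + ((m · 1# - 1#) - n · 1#)   ≈⟨ +-congˡ (+-assoc _ (- 1#) _) ⟩
    1# + (m · 1# + (- 1# - n · 1#)) ≈⟨ +-assoc 1# _ _ ⟨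
    (1# + m · 1#) + (- 1# - n · 1#) ≈⟨ +-cong (suc-· m) (sym (⁻¹-∙-comm 1# _)) ⟨
    suc m · 1# - (1# + n · 1#)      ≈⟨ +-congˡ (-‿cong (suc-· n)) ⟨
    suc m · 1# - suc n · 1#         ∎

  +-homo : ∀ i j → ⟦ i ℤ.+ j ⟧ ≈ ⟦ i ⟧ + ⟦ j ⟧
  +-homo (+ m)    (+ n)      = ×-homo-+ 1# m n
  +-homo (+ m)    -[1+ n ]   = ⟦⟧-⊖ m (suc n)
  +-homo -[1+ m ] (+ n)      = trans (⟦⟧-⊖ n (suc m)) (+-comm _ _)
  +-homo -[1+ m ] -[1+ n ]   = begin
    - (suc (suc (m ℕ.+ n)) · 1#)        ≡⟨ ≡.cong (λ k → - (k · 1#)) (≡.cong suc (≡.sym (ℕₚ.+-suc m n))) ⟩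
    - ((suc m ℕ.+ suc n) · 1#)          ≈⟨ -‿cong (×-homo-+ 1# (suc m) (suc n)) ⟩
    - (suc m · 1# + suc n · 1#)         ≈⟨ ⁻¹-∙-comm _ _ ⟨
    - (suc m · 1#) + - (suc n · 1#)     ∎

  -‿homo : ∀ i → ⟦ ℤ.- i ⟧ ≈ - ⟦ i ⟧
  -‿homo (+ zero)  = sym ε⁻¹≈ε
  -‿homo (+ suc n) = refl
  -‿homo -[1+ n ]  = sym (⁻¹-involutive _)

  +*-homo : ∀ m j → ⟦ + m ℤ.* j ⟧ ≈ m · 1# * ⟦ j ⟧
  +*-homo m (+ n) = begin
    ⟦ + m ℤ.* + n ⟧     ≡⟨ ≡.cong ⟦_⟧ (ℤₚ.pos-* m n) ⟨
    (m ℕ.* n) · 1#      ≈⟨ ×1-homo-* m n ⟩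
    m · 1# * (n · 1#)   ∎
  +*-homo m -[1+ n ] = begin
    ⟦ + m ℤ.* -[1+ n ] ⟧      ≡⟨ ≡.cong ⟦_⟧ (ℤₚ.neg-distribʳ-* (+ m) (+ suc n)) ⟨
    ⟦ ℤ.- (+ m ℤ.* + suc n) ⟧ ≈⟨ -‿homo (+ m ℤ.* + suc n) ⟩
    - ⟦ + m ℤ.* + suc n ⟧     ≈⟨ -‿cong (+*-homo m (+ suc n)) ⟩
    - (m · 1# * (suc n · 1#)) ≈⟨ -‿distribʳ-* _ _ ⟩
    m · 1# * - (suc n · 1#)   ∎

  *-homo : ∀ i j → ⟦ i ℤ.* j ⟧ ≈ ⟦ i ⟧ * ⟦ j ⟧
  *-homo (+ m)    j = +*-homo m j
  *-homo -[1+ m ] j = begin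
    ⟦ -[1+ m ] ℤ.* j ⟧        ≡⟨ ≡.cong ⟦_⟧ (ℤₚ.neg-distribˡ-* (+ suc m) j) ⟨
    ⟦ ℤ.- (+ suc m ℤ.* j) ⟧   ≈⟨ -‿homo (+ suc m ℤ.* j) ⟩
    - ⟦ + suc m ℤ.* j ⟧       ≈⟨ -‿cong (+*-homo (suc m) j) ⟩
    - (suc m · 1# * ⟦ j ⟧)    ≈⟨ -‿distribˡ-* _ _ ⟩
    - (suc m · 1#) * ⟦ j ⟧    ∎

  -- The solver normalises by comparing coefficients. Decidable equality of an abstract field does
  -- not compute, so coefficients are taken in ℤ, where it does.
  morphism : CommutativeRing.rawRing ℤₚ.+-*-commutativeRing
             -Raw-AlmostCommutative⟶ fromCommutativeRing R
  morphism = record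
    { ⟦_⟧ = ⟦_⟧ ; +-homo = +-homo ; *-homo = *-homo ; -‿homo = -‿homo
    ; 0-homo = refl ; 1-homo = refl }

  open Algebra.Solver.Ring _ _ morphism
    (λ i j → Maybe.map (λ i≡j → reflexive (≡.cong ⟦_⟧ i≡j)) (dec⇒maybe (i ℤₚ.≟ j)))
    public using (solve; con; _:=_; _:+_; _:*_; _:-_; :-_)

-- Ordered field arithmetic, the Archimedean property, Bernoulli's inequality

module OrderedField (em : ExcludedMiddle 0ℓ) (𝐑 : CompleteOrderedField) where
  open Real em 𝐑
  open IntegerCoefficients commutativeRing public
    using (solve; con; _:=_; _:+_; _:*_; _:-_; :-_)

  strictPartialOrder : StrictPartialOrder 0ℓ 0ℓ 0ℓ
  strictPartialOrder = record
    { isStrictPartialOrder = IsStrictTotalOrder.isStrictPartialOrder isStrictTotalOrder }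

  module ≤-Reasoning = StrictReasoning strictPartialOrder
  open ≤-Reasoning

  ≤-trans : ∀ {x y z} → x ≤ y → y ≤ z → x ≤ z
  ≤-trans x≤y y≤z = begin _ ≤⟨ x≤y ⟩ _ ≤⟨ y≤z ⟩ _ ∎

  <-≤-trans : ∀ {x y z} → x < y → y ≤ z → x < z
  <-≤-trans x<y y≤z = begin-strict _ <⟨ x<y ⟩ _ ≤⟨ y≤z ⟩ _ ∎

  ≤-<-trans : ∀ {x y z} → x ≤ y → y < z → x < z
  ≤-<-trans x≤y y<z = begin-strict _ ≤⟨ x≤y ⟩ _ <⟨ y<z ⟩ _ ∎

  ≤-antisym : ∀ {x y} → x ≤ y → y ≤ x → x ≈ y
  ≤-antisym = StrictToNonStrict.antisym _≈_ _<_ isEquivalence <-trans <-irrefl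

  ≤⇒≯ : ∀ {x y} → x ≤ y → ¬ y < x
  ≤⇒≯ x≤y y<x = <-irrefl ≈-refl (≤-<-trans x≤y y<x)

  <-≤-total : ∀ x y → x < y ⊎ y ≤ x
  <-≤-total x y with compare x y
  ... | tri< x<y _ _ = inj₁ x<y
  ... | tri≈ _ x≈y _ = inj₂ (inj₂ (≈-sym x≈y))
  ... | tri> _ _ y<x = inj₂ (inj₁ y<x)

  ≮⇒≥ : ∀ {x y} → ¬ x < y → y ≤ x
  ≮⇒≥ {x} {y} x≮y with <-≤-total x y
  ... | inj₁ x<y = contradiction x<y x≮y
  ... | inj₂ y≤x = y≤x

  ≤∧≉⇒< : ∀ {x y} → x ≤ y → ¬ x ≈ y → x < y
  ≤∧≉⇒< (inj₁ x<y) _   = x<y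
  ≤∧≉⇒< (inj₂ x≈y) x≉y = contradiction x≈y x≉y

  difference-positive : ∀ {x y} → x < y → 0# < y - x
  difference-positive {x} x<y = <-respˡ-≈ (-‿inverseʳ x) (+-monoˡ-< (- x) x<y)

  difference-nonnegative : ∀ {x y} → x ≤ y → 0# ≤ y - x
  difference-nonnegative     (inj₁ x<y) = inj₁ (difference-positive x<y)
  difference-nonnegative {x} (inj₂ x≈y) = inj₂ (≈-trans (≈-sym (-‿inverseʳ x)) (+-congʳ x≈y))

  -- Turns an inequality into the sign of an explicit difference plus a ring identity, which the
  -- solver settles.
  <-by : ∀ {x y} d → 0# < d → y - x ≈ d → x < y
  <-by {x} {y} d 0<d y-x≈d = begin-strict
    x              ≈⟨ +-identityˡ x ⟨
    0# + x         <⟨ +-monoˡ-< x (<-respʳ-≈ (≈-sym y-x≈d) 0<d) ⟩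
    (y - x) + x    ≈⟨ solve 2 (λ x y → (y :- x) :+ x := y) ≈-refl x y ⟩
    y              ∎

  ≤-by : ∀ {x y} d → 0# ≤ d → y - x ≈ d → x ≤ y
  ≤-by d (inj₁ 0<d) eq = inj₁ (<-by d 0<d eq)
  ≤-by {x} {y} d (inj₂ 0≈d) eq = inj₂ (begin-equality
    x              ≈⟨ +-identityˡ x ⟨
    0# + x         ≈⟨ +-congʳ (≈-trans 0≈d (≈-sym eq)) ⟩
    (y - x) + x    ≈⟨ solve 2 (λ x y → (y :- x) :+ x := y) ≈-refl x y ⟩
    y              ∎)

  +-monoʳ-< : ∀ z {x y} → x < y → z + x < z + y
  +-monoʳ-< z {x} {y} x<y = <-by (y - x) (difference-positive x<y)
    (solve 3 (λ x y z → (z :+ y) :- (z :+ x) := y :- x) ≈-refl x y z)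

  +-mono-≤ : ∀ {x y u v} → x ≤ y → u ≤ v → x + u ≤ y + v
  +-mono-≤ {x} {y} {u} {v} x≤y u≤v = ≤-trans
    (left x≤y) (right u≤v)
    where
    left : x ≤ y → x + u ≤ y + u
    left (inj₁ x<y) = inj₁ (+-monoˡ-< u x<y)
    left (inj₂ x≈y) = inj₂ (+-congʳ x≈y)
    right : u ≤ v → y + u ≤ y + v
    right (inj₁ u<v) = inj₁ (+-monoʳ-< y u<v)
    right (inj₂ u≈v) = inj₂ (+-congˡ u≈v)

  +-mono-< : ∀ {x y u v} → x < y → u < v → x + u < y + v
  +-mono-< {y = y} {u} x<y u<v = <-trans (+-monoˡ-< u x<y) (+-monoʳ-< y u<v)

  +-positive : ∀ {x y} → 0# < x → 0# < y → 0# < x + y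
  +-positive 0<x 0<y = <-respˡ-≈ (+-identityˡ 0#) (+-mono-< 0<x 0<y)

  +-nonnegative : ∀ {x y} → 0# ≤ x → 0# ≤ y → 0# ≤ x + y
  +-nonnegative 0≤x 0≤y = ≤-trans (inj₂ (≈-sym (+-identityˡ 0#))) (+-mono-≤ 0≤x 0≤y)

  *-nonnegative : ∀ {x y} → 0# ≤ x → 0# ≤ y → 0# ≤ x * y
  *-nonnegative (inj₁ 0<x) (inj₁ 0<y) = inj₁ (*-positive 0<x 0<y)
  *-nonnegative {x} (inj₁ _) (inj₂ 0≈y) = inj₂ (≈-trans (≈-sym (zeroʳ x)) (*-congˡ 0≈y))
  *-nonnegative {y = y} (inj₂ 0≈x) _ = inj₂ (≈-trans (≈-sym (zeroˡ y)) (*-congʳ 0≈x))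

  *-monoʳ-< : ∀ z {x y} → 0# < z → x < y → z * x < z * y
  *-monoʳ-< z {x} {y} 0<z x<y = <-by (z * (y - x)) (*-positive 0<z (difference-positive x<y))
    (solve 3 (λ x y z → (z :* y) :- (z :* x) := z :* (y :- x)) ≈-refl x y z)

  *-monoʳ-≤ : ∀ z {x y} → 0# ≤ z → x ≤ y → z * x ≤ z * y
  *-monoʳ-≤ z {x} {y} 0≤z x≤y =
    ≤-by (z * (y - x)) (*-nonnegative 0≤z (difference-nonnegative x≤y))
    (solve 3 (λ x y z → (z :* y) :- (z :* x) := z :* (y :- x)) ≈-refl x y z)

  *-cancelˡ-≤ : ∀ z {x y} → 0# < z → z * x ≤ z * y → x ≤ y
  *-cancelˡ-≤ z 0<z zx≤zy = ≮⇒≥ λ y<x → ≤⇒≯ zx≤zy (*-monoʳ-< z 0<z y<x)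

  *-cancelˡ-< : ∀ z {x y} → 0# < z → z * x < z * y → x < y
  *-cancelˡ-< z {x} {y} 0<z zx<zy with <-≤-total x y
  ... | inj₁ x<y = x<y
  ... | inj₂ y≤x = contradiction zx<zy (≤⇒≯ (*-monoʳ-≤ z (inj₁ 0<z) y≤x))

  -‿nonnegative : ∀ {x} → x ≤ 0# → 0# ≤ - x
  -‿nonnegative {x} x≤0 = ≤-trans (difference-nonnegative x≤0) (inj₂ (+-identityˡ (- x)))

  square-nonnegative : ∀ x → 0# ≤ x * x
  square-nonnegative x with <-≤-total 0# x
  ... | inj₁ 0<x = inj₁ (*-positive 0<x 0<x)
  ... | inj₂ x≤0 = ≤-trans (*-nonnegative (-‿nonnegative x≤0) (-‿nonnegative x≤0))
    (inj₂ (solve 1 (λ x → (:- x) :* (:- x) := x :* x) ≈-refl x))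

  x<x+ε : ∀ x {ε} → 0# < ε → x < x + ε
  x<x+ε x 0<ε = <-respˡ-≈ (+-identityʳ x) (+-monoʳ-< x 0<ε)

  ⁻¹-inverseˡ : ∀ {x} → 0# < x → x ⁻¹ * x ≈ 1#
  ⁻¹-inverseˡ 0<x = ≈-trans (*-comm _ _) (⁻¹-inverseʳ (positive⇒≉0 0<x))

  /-cancel : ∀ x {y} → 0# < y → x / y * y ≈ x
  /-cancel x 0<y = ≈-trans (*-assoc x _ _) (≈-trans (*-congˡ (⁻¹-inverseˡ 0<y)) (*-identityʳ x))

  *-cancelˡ-≈ : ∀ z {x y} → 0# < z → z * x ≈ z * y → x ≈ y
  *-cancelˡ-≈ z 0<z eq = ≤-antisym (*-cancelˡ-≤ z 0<z (inj₂ eq)) (*-cancelˡ-≤ z 0<z (inj₂ (≈-sym eq)))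

  ⁻¹-unique : ∀ {x y} → 0# < x → x * y ≈ 1# → y ≈ x ⁻¹
  ⁻¹-unique {x} 0<x xy≈1 =
    *-cancelˡ-≈ x 0<x (≈-trans xy≈1 (≈-sym (⁻¹-inverseʳ (positive⇒≉0 0<x))))

  half : ∀ {ε} → 0# < ε → ∃ λ δ → 0# < δ × δ + δ ≈ ε
  half {ε} 0<ε = ε / two , *-positive 0<ε (⁻¹-positive 0<two) ,
    ≈-trans (solve 1 (λ x → x :+ x := x :* (con 1ℤ :+ con 1ℤ)) ≈-refl (ε / two)) (/-cancel ε 0<two)
    where
    two = 1# + 1#
    0<two = +-positive 0<1 0<1

  dense : ∀ {x y} → x < y → ∃ λ z → x < z × z < y
  dense {x} {y} x<y with half (difference-positive x<y)
  ... | δ , 0<δ , 2δ≈y-x = x + δ , x<x+ε x 0<δ , <-by δ 0<δ (begin-equality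
    y - (x + δ)   ≈⟨ solve 3 (λ x y d → y :- (x :+ d) := (y :- x) :- d) ≈-refl x y δ ⟩
    (y - x) - δ   ≈⟨ +-congʳ 2δ≈y-x ⟨
    (δ + δ) - δ   ≈⟨ solve 1 (λ d → (d :+ d) :- d := d) ≈-refl δ ⟩
    δ             ∎)

  fromℕ-+ : ∀ m n → fromℕ (m ℕ.+ n) ≈ fromℕ m + fromℕ n
  fromℕ-+ zero    n = ≈-sym (+-identityˡ _)
  fromℕ-+ (suc m) n = ≈-trans (+-congˡ (fromℕ-+ m n)) (≈-sym (+-assoc _ _ _))

  fromℕ-nonnegative : ∀ n → 0# ≤ fromℕ n
  fromℕ-nonnegative zero    = inj₂ ≈-refl
  fromℕ-nonnegative (suc n) = +-nonnegative (inj₁ 0<1) (fromℕ-nonnegative n)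

  fromℕ-suc-positive : ∀ n → 0# < fromℕ (suc n)
  fromℕ-suc-positive n = <-≤-trans 0<1
    (≤-by (fromℕ n) (fromℕ-nonnegative n) (solve 1 (λ n → (con 1ℤ :+ n) :- con 1ℤ := n) ≈-refl (fromℕ n)))

  fromℕ-positive : ∀ {n} → 0 ℕ.< n → 0# < fromℕ n
  fromℕ-positive {suc n} _ = fromℕ-suc-positive n

  fromℕ-mono-≤ : ∀ {m n} → m ℕ.≤ n → fromℕ m ≤ fromℕ n
  fromℕ-mono-≤ {n = n} ℕ.z≤n = fromℕ-nonnegative n
  fromℕ-mono-≤ (ℕ.s≤s m≤n) = +-mono-≤ (inj₂ ≈-refl) (fromℕ-mono-≤ m≤n)

  fromℕ-cancel-≤ : ∀ {m n} → fromℕ m ≤ fromℕ n → m ℕ.≤ n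
  fromℕ-cancel-≤ {m} {n} m≤n = ℕₚ.≮⇒≥ λ n<m →
    ≤⇒≯ (≤-trans (fromℕ-mono-≤ n<m) m≤n)
      (<-respʳ-≈ (+-comm _ _) (x<x+ε (fromℕ n) 0<1))

  -- If the naturals were bounded, their supremum `s` would satisfy n + 1 ≤ s for all n, so `s - 1#`
  -- would be a smaller bound.
  archimedean : ∀ x → ∃ λ n → x < fromℕ n
  archimedean x with em {∃ λ n → x < fromℕ n}
  ... | yes found = found
  ... | no  none with supremum (λ y → ∃ λ n → y ≈ fromℕ n) (0# , 0 , ≈-refl)
                        (x , λ { y (n , y≈n) → ≤-trans (inj₂ y≈n) (≮⇒≥ λ x<n → none (n , x<n)) })
  ... | s , bound , least = contradiction s-1<s (≤⇒≯ (least (s - 1#) bound′))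
    where
    s-1<s : s - 1# < s
    s-1<s = <-by 1# 0<1 (solve 1 (λ s → s :- (s :- con 1ℤ) := con 1ℤ) ≈-refl s)
    bound′ : (s - 1#) IsUpperBoundOf (λ y → ∃ λ n → y ≈ fromℕ n)
    bound′ y (n , y≈n) = ≤-by (s - fromℕ (suc n))
      (difference-nonnegative (bound (fromℕ (suc n)) (suc n , ≈-refl)))
      (≈-trans (+-congˡ (-‿cong y≈n))
        (solve 2 (λ s n → (s :- con 1ℤ) :- n := s :- (con 1ℤ :+ n)) ≈-refl s (fromℕ n)))

  -- An Archimedean bound is lowered one step at a time while it stays above `x`. The strict upper
  -- estimate is essential later: it forces the ceiling of zero to be zero.
  ceiling : ∀ {x} → 0# ≤ x → ∃ λ k → x ≤ fromℕ k × fromℕ k < x + 1#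
  ceiling {x} 0≤x = below (proj₁ (archimedean x)) (inj₁ (proj₂ (archimedean x)))
    where
    below : ∀ n → x ≤ fromℕ n → ∃ λ k → x ≤ fromℕ k × fromℕ k < x + 1#
    below zero    x≤0 = 0 , x≤0 , ≤-<-trans 0≤x (x<x+ε x 0<1)
    below (suc n) x≤1+n with <-≤-total (fromℕ n) x
    ... | inj₁ n<x = suc n , x≤1+n , <-respˡ-≈ (+-comm _ _) (+-monoˡ-< 1# n<x)
    ... | inj₂ x≤n = below n x≤n

  ^-nonnegative : ∀ {x} n → 0# ≤ x → 0# ≤ x ^ n
  ^-nonnegative zero    0≤x = inj₁ 0<1
  ^-nonnegative (suc n) 0≤x = *-nonnegative 0≤x (^-nonnegative n 0≤x)

  ^-positive : ∀ {x} n → 0# < x → 0# < x ^ n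
  ^-positive zero    0<x = 0<1
  ^-positive (suc n) 0<x = *-positive 0<x (^-positive n 0<x)

  1^n≈1 : ∀ n → 1# ^ n ≈ 1#
  1^n≈1 zero    = ≈-refl
  1^n≈1 (suc n) = ≈-trans (*-identityˡ _) (1^n≈1 n)

  ^-≤1 : ∀ {x} n → 0# ≤ x → x ≤ 1# → x ^ n ≤ 1#
  ^-≤1 zero    0≤x x≤1 = inj₂ ≈-refl
  ^-≤1 {x} (suc n) 0≤x x≤1 = begin
    x * x ^ n   ≤⟨ *-monoʳ-≤ x 0≤x (^-≤1 n 0≤x x≤1) ⟩
    x * 1#      ≈⟨ *-identityʳ x ⟩
    x           ≤⟨ x≤1 ⟩
    1#          ∎

  -- Weighted AM-GM for n copies of a and one of (n + 1) b - n a.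
  am-gm : ∀ {a b} n → 0# ≤ a → 0# ≤ b →
          a ^ n * (fromℕ (suc n) * b - fromℕ n * a) ≤ b ^ suc n
  am-gm {a} {b} zero 0≤a 0≤b = inj₂
    (solve 2 (λ a b → con 1ℤ :* ((con 1ℤ :+ con 0ℤ) :* b :- con 0ℤ :* a) := b :* con 1ℤ) ≈-refl a b)
  -- The defect for n + 1 is b times the defect for n plus a square term, because b((n+1)b - na) -
  -- a((n+2)b - (n+1)a) = (n+1)(b - a)².
  am-gm {a} {b} (suc n) 0≤a 0≤b = ≤-by
    (b * (b ^ suc n - a ^ n * (fromℕ (suc n) * b - fromℕ n * a)) +
      a ^ n * fromℕ (suc n) * ((b - a) * (b - a)))
    (+-nonnegative
      (*-nonnegative 0≤b (difference-nonnegative (am-gm n 0≤a 0≤b)))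
      (*-nonnegative (*-nonnegative (^-nonnegative n 0≤a) (fromℕ-nonnegative (suc n)))
        (square-nonnegative (b - a))))
    (solve 5 (λ a b A B N →
        b :* B :- a :* A :* ((con 1ℤ :+ (con 1ℤ :+ N)) :* b :- (con 1ℤ :+ N) :* a) :=
        b :* (B :- A :* ((con 1ℤ :+ N) :* b :- N :* a)) :+ A :* (con 1ℤ :+ N) :* ((b :- a) :* (b :- a)))
      ≈-refl a b (a ^ n) (b ^ suc n) (fromℕ n))

  -- This is `am-gm` at `a = 1`, hence valid for increments `x - 1#` down to -1.
  bernoulli : ∀ {x} n → 0# ≤ x → 1# + fromℕ (suc n) * (x - 1#) ≤ x ^ suc n
  bernoulli {x} n 0≤x = begin
    1# + fromℕ (suc n) * (x - 1#)
      ≈⟨ solve 2 (λ x N → con 1ℤ :+ (con 1ℤ :+ N) :* (x :- con 1ℤ) :=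
                          con 1ℤ :* ((con 1ℤ :+ N) :* x :- N :* con 1ℤ)) ≈-refl x (fromℕ n) ⟩
    1# * (fromℕ (suc n) * x - fromℕ n * 1#)       ≈⟨ *-congʳ (1^n≈1 n) ⟨
    1# ^ n * (fromℕ (suc n) * x - fromℕ n * 1#)   ≤⟨ am-gm n (inj₁ 0<1) 0≤x ⟩
    x ^ suc n                                     ∎

-- Limits of real sequences

Eventually : (ℕ → Set) → Set
Eventually P = ∃ λ N → ∀ n → N ℕ.≤ n → P n

always : ∀ {P} → (∀ n → P n) → Eventually P
always p = 0 , λ n _ → p n

eventually-map : ∀ {P Q} → (∀ {n} → P n → Q n) → Eventually P → Eventually Q
eventually-map f (N , p) = N , λ n N≤n → f (p n N≤n)

eventually-× : ∀ {P Q} → Eventually P → Eventually Q → Eventually (λ n → P n × Q n)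
eventually-× (M , p) (N , q) = M ℕ.⊔ N , λ n h →
  p n (ℕₚ.m⊔n≤o⇒m≤o M N h) , q n (ℕₚ.m⊔n≤o⇒n≤o M N h)

eventually-witness : ∀ {P} → Eventually P → ∃ P
eventually-witness (N , p) = N , p N ℕₚ.≤-refl

module Limits (em : ExcludedMiddle 0ℓ) (𝐑 : CompleteOrderedField) where
  open Real em 𝐑
  open OrderedField em 𝐑
  open ≤-Reasoning
  open MonoidSum +-commutativeMonoid using (sum)

  ⇝-below : ∀ {s l b} → s ⇝ l → l < b → Eventually λ n → s n < b
  ⇝-below {s} {l} {b} s⇝l l<b = eventually-map
    (λ close → <-respʳ-≈ (solve 2 (λ l b → l :+ (b :- l) := b) ≈-refl l b) (proj₁ close))
    (s⇝l (b - l) (difference-positive l<b))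

  ⇝-above : ∀ {s l a} → s ⇝ l → a < l → Eventually λ n → a < s n
  ⇝-above {s} {l} {a} s⇝l a<l = eventually-map
    (λ {n} close → <-by (s n + (l - a) - l) (difference-positive (proj₂ close))
      (solve 3 (λ l a s → s :- a := s :+ (l :- a) :- l) ≈-refl l a (s n)))
    (s⇝l (l - a) (difference-positive a<l))

  -- Convergence expressed by the order alone, a form that monotone functions and comparisons
  -- transport without any estimate.
  ⇝-between : ∀ {s l} → (∀ a → a < l → Eventually λ n → a < s n) →
              (∀ b → l < b → Eventually λ n → s n < b) → s ⇝ l
  ⇝-between {s} {l} above below ε 0<ε = eventually-map
    (λ {n} (s<l+ε , l-ε<s) → s<l+ε , <-by (s n - (l - ε)) (difference-positive l-ε<s)
      (solve 3 (λ l e s → s :+ e :- l := s :- (l :- e)) ≈-refl l ε (s n)))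
    (eventually-× (below (l + ε) (x<x+ε l 0<ε))
      (above (l - ε) (<-by ε 0<ε (solve 2 (λ l e → l :- (l :- e) := e) ≈-refl l ε))))

  ⇝-cong : ∀ {s t l k} → (∀ n → s n ≈ t n) → l ≈ k → s ⇝ l → t ⇝ k
  ⇝-cong s≈t l≈k s⇝l ε 0<ε = eventually-map
    (λ {n} (p , q) → <-respʳ-≈ (+-congʳ l≈k) (<-respˡ-≈ (s≈t n) p) ,
                     <-respʳ-≈ (+-congʳ (s≈t n)) (<-respˡ-≈ l≈k q))
    (s⇝l ε 0<ε)

  ⇝-const : ∀ l → (λ _ → l) ⇝ l
  ⇝-const l ε 0<ε = always λ _ → x<x+ε l 0<ε , x<x+ε l 0<ε

  ⇝-≤ : ∀ {s t l k} → s ⇝ l → t ⇝ k → Eventually (λ n → s n ≤ t n) → l ≤ k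
  ⇝-≤ {s} {t} {l} {k} s⇝l t⇝k s≤t = ≮⇒≥ λ k<l →
    let c , k<c , c<l = dense k<l
        n , (c<s , t<c) , s≤t = eventually-witness
          (eventually-× (eventually-× (⇝-above s⇝l c<l) (⇝-below t⇝k k<c)) s≤t)
    in ≤⇒≯ s≤t (<-trans t<c c<s)

  ⇝-unique : ∀ {s l k} → s ⇝ l → s ⇝ k → l ≈ k
  ⇝-unique s⇝l s⇝k = ≤-antisym (⇝-≤ s⇝l s⇝k ≤-self) (⇝-≤ s⇝k s⇝l ≤-self)
    where ≤-self = always λ _ → inj₂ ≈-refl

  ⇝-squeeze : ∀ {s t u l} → s ⇝ l → u ⇝ l → (∀ n → s n ≤ t n) → (∀ n → t n ≤ u n) → t ⇝ l
  ⇝-squeeze s⇝l u⇝l s≤t t≤u = ⇝-between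
    (λ a a<l → eventually-map (λ {n} a<s → <-≤-trans a<s (s≤t n)) (⇝-above s⇝l a<l))
    (λ b l<b → eventually-map (λ {n} u<b → ≤-<-trans (t≤u n) u<b) (⇝-below u⇝l l<b))

  Close-+ : ∀ {δ ε x x′ y y′} → Close δ x x′ → Close ε y y′ → Close (δ + ε) (x + y) (x′ + y′)
  Close-+ (p , p′) (q , q′) = add p q , add p′ q′
    where
    add : ∀ {x y d u v e} → x < y + d → u < v + e → x + u < y + v + (d + e)
    add {x} {y} {d} {u} {v} {e} x<y+d u<v+e = <-respʳ-≈
      (solve 4 (λ y d v e → (y :+ d) :+ (v :+ e) := (y :+ v) :+ (d :+ e)) ≈-refl y d v e)
      (+-mono-< x<y+d u<v+e)

  Close-resp : ∀ {δ ε x y} → δ ≈ ε → Close δ x y → Close ε x y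
  Close-resp δ≈ε (p , q) = <-respʳ-≈ (+-congˡ δ≈ε) p , <-respʳ-≈ (+-congˡ δ≈ε) q

  Close-mono : ∀ {δ ε x y} → δ ≤ ε → Close δ x y → Close ε x y
  Close-mono δ≤ε (p , q) =
    <-≤-trans p (+-mono-≤ (inj₂ ≈-refl) δ≤ε) , <-≤-trans q (+-mono-≤ (inj₂ ≈-refl) δ≤ε)

  ⇝-+ : ∀ {s t l k} → s ⇝ l → t ⇝ k → (λ n → s n + t n) ⇝ l + k
  ⇝-+ s⇝l t⇝k ε 0<ε with half 0<ε
  ... | δ , 0<δ , 2δ≈ε = eventually-map
    (λ (p , q) → Close-resp 2δ≈ε (Close-+ p q))
    (eventually-× (s⇝l δ 0<δ) (t⇝k δ 0<δ))

  ⇝-sum : ∀ {n} {s : Fin n → ℕ → ℝ} {l : Fin n → ℝ} → (∀ i → s i ⇝ l i) →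
          (λ m → sum (λ i → s i m)) ⇝ sum l
  ⇝-sum {zero}  s⇝l = ⇝-const 0#
  ⇝-sum {suc n} s⇝l = ⇝-+ (s⇝l zero) (⇝-sum (s⇝l ∘ suc))

  -- No signs need be distinguished: (δ - x)(ε + y) + (δ + x)(ε - y) = 2(δε - xy), where all four
  -- factors on the left are positive; changing the sign of `y` gives the other bound.
  Close-* : ∀ {δ ε x y} → Close δ x 0# → Close ε y 0# → Close (δ * ε) (x * y) 0#
  Close-* {δ} {ε} {x} {y} (x<δ , -δ<x) (y<ε , -ε<y) =
    halve (<-respʳ-≈
      (solve 4 (λ d e x y →
        (con 0ℤ :+ d :- x) :* (y :+ e :- con 0ℤ) :+ (x :+ d :- con 0ℤ) :* (con 0ℤ :+ e :- y) :=
        (con 0ℤ :+ d :* e :- x :* y) :+ (con 0ℤ :+ d :* e :- x :* y)) ≈-refl δ ε x y)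
      (+-positive
        (*-positive (difference-positive x<δ) (difference-positive -ε<y))
        (*-positive (difference-positive -δ<x) (difference-positive y<ε)))) ,
    halve (<-respʳ-≈
      (solve 4 (λ d e x y →
        (x :+ d :- con 0ℤ) :* (y :+ e :- con 0ℤ) :+ (con 0ℤ :+ d :- x) :* (con 0ℤ :+ e :- y) :=
        (x :* y :+ d :* e :- con 0ℤ) :+ (x :* y :+ d :* e :- con 0ℤ)) ≈-refl δ ε x y)
      (+-positive
        (*-positive (difference-positive -δ<x) (difference-positive -ε<y))
        (*-positive (difference-positive x<δ) (difference-positive y<ε))))
    where
    halve : ∀ {u v} → 0# < (v - u) + (v - u) → u < v
    halve {u} {v} 0<2d with <-≤-total u v
    ... | inj₁ u<v = u<v
    ... | inj₂ v≤u = contradiction 0<2d (≤⇒≯ (≤-by ((u - v) + (u - v))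
      (+-nonnegative (difference-nonnegative v≤u) (difference-nonnegative v≤u))
      (solve 2 (λ u v → con 0ℤ :- ((v :- u) :+ (v :- u)) := (u :- v) :+ (u :- v)) ≈-refl u v)))

  null-* : ∀ {s t} → s ⇝ 0# → t ⇝ 0# → (λ n → s n * t n) ⇝ 0#
  null-* s⇝0 t⇝0 ε 0<ε = eventually-map
    (λ (p , q) → Close-resp (*-identityʳ ε) (Close-* p q))
    (eventually-× (s⇝0 ε 0<ε) (t⇝0 1# 0<1))

  bounded : ∀ x → ∃ λ c → 0# < c × Close c x 0#
  bounded x with <-≤-total 0# x
  ... | inj₁ 0<x = x + 1# , +-positive 0<x 0<1 ,
    <-by 1# 0<1 (solve 1 (λ x → con 0ℤ :+ (x :+ con 1ℤ) :- x := con 1ℤ) ≈-refl x) ,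
    +-positive 0<x (+-positive 0<x 0<1)
  ... | inj₂ x≤0 = - x + 1# , ≤-<-trans (-‿nonnegative x≤0) (x<x+ε (- x) 0<1) ,
    <-by (- x + (- x + 1#))
      (≤-<-trans (+-nonnegative (-‿nonnegative x≤0) (-‿nonnegative x≤0))
        (<-respʳ-≈ (+-assoc _ _ _) (x<x+ε (- x + - x) 0<1)))
      (solve 1 (λ x → con 0ℤ :+ (:- x :+ con 1ℤ) :- x := :- x :+ (:- x :+ con 1ℤ)) ≈-refl x) ,
    <-respʳ-≈ (solve 1 (λ x → con 1ℤ := x :+ (:- x :+ con 1ℤ)) ≈-refl x) 0<1

  null-*ˡ : ∀ k {s} → s ⇝ 0# → (λ n → k * s n) ⇝ 0#
  null-*ˡ k s⇝0 ε 0<ε with bounded k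
  ... | c , 0<c , close = eventually-map
    (λ p → Close-resp (≈-trans (*-comm c (ε / c)) (/-cancel ε 0<c)) (Close-* close p))
    (s⇝0 (ε / c) (*-positive 0<ε (⁻¹-positive 0<c)))

  ⇝-* : ∀ {s t l k} → s ⇝ l → t ⇝ k → (λ n → s n * t n) ⇝ l * k
  ⇝-* {s} {t} {l} {k} s⇝l t⇝k = ⇝-cong
    (λ n → solve 4 (λ s t l k →
        (s :- l) :* (t :- k) :+ (l :* (t :- k) :+ k :* (s :- l)) :+ l :* k := s :* t)
      ≈-refl (s n) (t n) l k)
    (solve 1 (λ x → con 0ℤ :+ (con 0ℤ :+ con 0ℤ) :+ x := x) ≈-refl (l * k))
    (⇝-+ (⇝-+ (null-* (shift s⇝l) (shift t⇝k)) (⇝-+ (null-*ˡ l (shift t⇝k)) (null-*ˡ k (shift s⇝l))))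
         (⇝-const (l * k)))
    where
    shift : ∀ {s l} → s ⇝ l → (λ n → s n - l) ⇝ 0#
    shift {l = l} s⇝l = ⇝-cong (λ _ → ≈-refl) (-‿inverseʳ l) (⇝-+ s⇝l (⇝-const (- l)))

  ⇝-neg : ∀ {s l} → s ⇝ l → (λ n → - s n) ⇝ - l
  ⇝-neg s⇝l = ⇝-cong (λ n → neg _) (neg _) (⇝-* (⇝-const (- 1#)) s⇝l)
    where
    neg : ∀ x → - 1# * x ≈ - x
    neg = solve 1 (λ x → :- con 1ℤ :* x := :- x) ≈-refl

  reciprocal : ℕ → ℝ
  reciprocal n = fromℕ (suc n) ⁻¹

  reciprocal-inverse : ∀ n → fromℕ (suc n) * reciprocal n ≈ 1#
  reciprocal-inverse n = ⁻¹-inverseʳ (positive⇒≉0 (fromℕ-suc-positive n))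

  reciprocal⇝0 : reciprocal ⇝ 0#
  reciprocal⇝0 = ⇝-between
    (λ a a<0 → always λ n → <-trans a<0 (⁻¹-positive (fromℕ-suc-positive n)))
    (λ b 0<b → let N , 1/b<N = archimedean (b ⁻¹) in N , λ n N≤n →
      *-cancelˡ-< (fromℕ (suc n)) (fromℕ-suc-positive n) (begin-strict
        fromℕ (suc n) * reciprocal n   ≈⟨ reciprocal-inverse n ⟩
        1#                             ≈⟨ ⁻¹-inverseʳ (positive⇒≉0 0<b) ⟨
        b * b ⁻¹                       <⟨ *-monoʳ-< b 0<b 1/b<N ⟩
        b * fromℕ N                    ≤⟨ *-monoʳ-≤ b (inj₁ 0<b) (fromℕ-mono-≤ (ℕₚ.m≤n⇒m≤1+n N≤n)) ⟩
        b * fromℕ (suc n)              ≈⟨ *-comm _ _ ⟩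
        fromℕ (suc n) * b              ∎))

  steps⇒monotone : ∀ (s : ℕ → ℝ) {N} → (∀ n → N ℕ.≤ n → s n ≤ s (suc n)) →
                   ∀ {m n} → N ℕ.≤ m → m ℕ.≤′ n → s m ≤ s n
  steps⇒monotone s step N≤m (ℕ.≤′-reflexive ≡.refl) = inj₂ ≈-refl
  steps⇒monotone s step N≤m (ℕ.≤′-step m≤n) =
    ≤-trans (steps⇒monotone s step N≤m m≤n) (step _ (ℕₚ.≤-trans N≤m (ℕₚ.≤′⇒≤ m≤n)))

  monotone-convergence : ∀ {s b} N → (∀ n → N ℕ.≤ n → s n ≤ s (suc n)) →
                         (∀ n → N ℕ.≤ n → s n ≤ b) → ∃ (s ⇝_)
  monotone-convergence {s} {b} N step s≤b
    with supremum (λ y → ∃ λ n → N ℕ.≤ n × y ≈ s n) (s N , N , ℕₚ.≤-refl , ≈-refl)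
           (b , λ { y (n , N≤n , y≈s) → ≤-trans (inj₂ y≈s) (s≤b n N≤n) })
  ... | l , isBound , least = l , ⇝-between above
    (λ b l<b → N , λ n N≤n → ≤-<-trans (isBound (s n) (n , N≤n , ≈-refl)) l<b)
    where
    above : ∀ a → a < l → Eventually λ n → a < s n
    above a a<l with em {∃ λ n → N ℕ.≤ n × a < s n}
    ... | yes (m , N≤m , a<s) = m , λ n m≤n → <-≤-trans a<s (steps⇒monotone s step N≤m (ℕₚ.≤⇒≤′ m≤n))
    ... | no  none = contradiction a<l (≤⇒≯ (least a λ { y (n , N≤n , y≈s) →
      ≤-trans (inj₂ y≈s) (≮⇒≥ λ a<s → none (n , N≤n , a<s)) }))

  lim-≈ : ∀ {s l} → s ⇝ l → lim s ≈ l
  lim-≈ {s} {l} s⇝l with em {∃ (s ⇝_)}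
  ... | yes (k , s⇝k) = ⇝-unique s⇝k s⇝l
  ... | no  none      = contradiction (l , s⇝l) none

-- Consequences of the exponential laws; logarithm and real powers

module ExponentialFunction (em : ExcludedMiddle 0ℓ) (𝐑 : CompleteOrderedField) where
  open Real em 𝐑 hiding (exp; ln; _^ᴿ_)
  open OrderedField em 𝐑
  open Limits em 𝐑
  open ≤-Reasoning

  -- Strict monotonicity, surjectivity, logarithms and the asymptotic calculus rest on these laws,
  -- independently of how `exp` is constructed. The tangent bound `1+x≤exp` is the only analytic
  -- input.
  record IsExponential (exp : ℝ → ℝ) : Set where
    field
      exp-cong     : ∀ {x y} → x ≈ y → exp x ≈ exp y
      exp-positive : ∀ x → 0# < exp x
      exp-+        : ∀ x y → exp (x + y) ≈ exp x * exp y
      exp-neg      : ∀ x → exp x * exp (- x) ≈ 1#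
      1+x≤exp      : ∀ x → 1# + x ≤ exp x

    exp-nonnegative : ∀ x → 0# ≤ exp x
    exp-nonnegative x = inj₁ (exp-positive x)

    exp-mono-< : ∀ {x y} → x < y → exp x < exp y
    exp-mono-< {x} {y} x<y = begin-strict
      exp x                   ≈⟨ *-identityʳ _ ⟨
      exp x * 1#              <⟨ *-monoʳ-< _ (exp-positive x) (<-≤-trans (x<x+ε 1# (difference-positive x<y)) (1+x≤exp (y - x))) ⟩
      exp x * exp (y - x)     ≈⟨ exp-+ x (y - x) ⟨
      exp (x + (y - x))       ≈⟨ exp-cong (solve 2 (λ x y → x :+ (y :- x) := y) ≈-refl x y) ⟩
      exp y                   ∎

    exp-cancel-< : ∀ {x y} → exp x < exp y → x < y
    exp-cancel-< {x} {y} ex<ey with compare x y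
    ... | tri< x<y _ _ = x<y
    ... | tri≈ _ x≈y _ = contradiction ex<ey (<-irrefl (exp-cong x≈y))
    ... | tri> _ _ y<x = contradiction ex<ey (<-asym (exp-mono-< y<x))

    exp-injective : ∀ {x y} → exp x ≈ exp y → x ≈ y
    exp-injective {x} {y} ex≈ey with compare x y
    ... | tri< x<y _ _ = contradiction (exp-mono-< x<y) (<-irrefl ex≈ey)
    ... | tri≈ _ x≈y _ = x≈y
    ... | tri> _ _ y<x = contradiction (exp-mono-< y<x) (<-irrefl (≈-sym ex≈ey))

    exp*[1-x]≤1 : ∀ x → exp x * (1# - x) ≤ 1#
    exp*[1-x]≤1 x = ≤-trans (*-monoʳ-≤ _ (exp-nonnegative x) (1+x≤exp (- x))) (inj₂ (exp-neg x))

    -- The solution is the supremum `s` of the `x` with `exp x ≤ y`. Continuity is not yet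
    -- available, since its proof goes through `ln`; the tangent bounds at explicit steps `δ`
    -- replace it and exclude both strict inequalities between `exp s` and `y`.
    exp-surjective : ∀ {y} → 0# < y → ∃ λ x → exp x ≈ y
    exp-surjective {y} 0<y with supremum (λ x → exp x ≤ y) (- (y ⁻¹) , small) (y , λ x → large x)
      where
      small : exp (- (y ⁻¹)) ≤ y
      small = *-cancelˡ-≤ (exp (y ⁻¹)) (exp-positive _) (begin
        exp (y ⁻¹) * exp (- (y ⁻¹))  ≈⟨ exp-neg (y ⁻¹) ⟩
        1#                           ≈⟨ ⁻¹-inverseˡ 0<y ⟨
        y ⁻¹ * y                     ≈⟨ *-comm _ _ ⟩
        y * y ⁻¹                     ≤⟨ *-monoʳ-≤ y (inj₁ 0<y) (≤-trans
          (≤-by 1# (inj₁ 0<1) (solve 1 (λ z → con 1ℤ :+ z :- z := con 1ℤ) ≈-refl (y ⁻¹))) (1+x≤exp (y ⁻¹))) ⟩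
        y * exp (y ⁻¹)               ≈⟨ *-comm _ _ ⟩
        exp (y ⁻¹) * y               ∎)
      large : ∀ x → exp x ≤ y → x ≤ y
      large x ex≤y = ≤-trans (≤-by 1# (inj₁ 0<1) (solve 1 (λ z → con 1ℤ :+ z :- z := con 1ℤ) ≈-refl x))
        (≤-trans (1+x≤exp x) ex≤y)
    ... | s , isBound , least with compare (exp s) y
    ...   | tri≈ _ es≈y _ = s , es≈y
    ...   | tri< es<y _ _ = contradiction (isBound (s + δ) exceeds) (λ s+δ≤s → ≤⇒≯ s+δ≤s (x<x+ε s 0<δ))
      where
      -- Chosen so that exp s = y(1 - δ); then exp (s + δ) = y(1 - δ) exp δ ≤ y, and `s` was not an
      -- upper bound.
      δ = (y - exp s) / y
      0<δ = *-positive (difference-positive es<y) (⁻¹-positive 0<y)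
      exceeds : exp (s + δ) ≤ y
      exceeds = *-cancelˡ-≤ (exp s) (exp-positive s) (begin
        exp s * exp (s + δ)             ≈⟨ *-congˡ (exp-+ s δ) ⟩
        exp s * (exp s * exp δ)         ≈⟨ *-congˡ (*-congʳ es≈) ⟩
        exp s * (y * (1# - δ) * exp δ)  ≈⟨ solve 4 (λ s y d e → s :* (y :* (con 1ℤ :- d) :* e) := (s :* y) :* (e :* (con 1ℤ :- d)))
                                             ≈-refl (exp s) y δ (exp δ) ⟩
        exp s * y * (exp δ * (1# - δ))  ≤⟨ *-monoʳ-≤ _ (inj₁ (*-positive (exp-positive s) 0<y)) (exp*[1-x]≤1 δ) ⟩
        exp s * y * 1#                  ≈⟨ *-identityʳ _ ⟩
        exp s * y                       ∎)
        where
        es≈ : exp s ≈ y * (1# - δ)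
        es≈ = begin-equality
          exp s              ≈⟨ solve 2 (λ s y → s := y :- (y :- s)) ≈-refl (exp s) y ⟩
          y - (y - exp s)    ≈⟨ +-congˡ (-‿cong (/-cancel (y - exp s) 0<y)) ⟨
          y - δ * y          ≈⟨ solve 2 (λ y d → y :- d :* y := y :* (con 1ℤ :- d)) ≈-refl y δ ⟩
          y * (1# - δ)       ∎
    ...   | tri> _ _ y<es = contradiction (least (s - δ) below)
        (λ s≤s-δ → ≤⇒≯ s≤s-δ (<-by δ 0<δ (solve 2 (λ s d → s :- (s :- d) := d) ≈-refl s δ)))
      where
      -- Chosen so that y = exp s (1 - δ) ≤ exp (s - δ); then `s - δ` is already an upper bound.
      δ = (exp s - y) / exp s
      0<δ = *-positive (difference-positive y<es) (⁻¹-positive (exp-positive s))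
      below : ∀ x → exp x ≤ y → x ≤ s - δ
      below x ex≤y = ≮⇒≥ λ s-δ<x → ≤⇒≯ ex≤y (≤-<-trans y≤ (exp-mono-< s-δ<x))
        where
        y≤ : y ≤ exp (s - δ)
        y≤ = begin
          y                           ≈⟨ solve 2 (λ s y → y := s :- (s :- y)) ≈-refl (exp s) y ⟩
          exp s - (exp s - y)         ≈⟨ +-congˡ (-‿cong (/-cancel (exp s - y) (exp-positive s))) ⟨
          exp s - δ * exp s           ≈⟨ solve 2 (λ s d → s :- d :* s := s :* (con 1ℤ :+ (:- d))) ≈-refl (exp s) δ ⟩
          exp s * (1# - δ)            ≤⟨ *-monoʳ-≤ _ (exp-nonnegative s) (1+x≤exp (- δ)) ⟩
          exp s * exp (- δ)           ≈⟨ exp-+ s (- δ) ⟨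
          exp (s - δ)                 ∎

  module Logarithm {exp ln : ℝ → ℝ} (isExponential : IsExponential exp)
                   (exp-ln : ∀ {y} → 0# < y → exp (ln y) ≈ y) where
    open IsExponential isExponential

    infixr 8 _^ᴿ_
    _^ᴿ_ : ℝ → ℝ → ℝ
    x ^ᴿ a = exp (a * ln x)

    ln-unique : ∀ {x y} → exp x ≈ y → ln y ≈ x
    ln-unique {x} ex≈y = exp-injective
      (≈-trans (exp-ln (<-respʳ-≈ ex≈y (exp-positive x))) (≈-sym ex≈y))

    -- An increasing function onto the positive reals is continuous: positive bounds on `exp (s n)`
    -- become bounds on `s n` by `ln`. Bounds `a ≤ 0` are outside the range of `exp` and hold
    -- trivially.
    ⇝-exp : ∀ {s l} → s ⇝ l → (λ n → exp (s n)) ⇝ exp l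
    ⇝-exp {s} {l} s⇝l = ⇝-between above below
      where
      above : ∀ a → a < exp l → Eventually λ n → a < exp (s n)
      above a a<el with <-≤-total 0# a
      ... | inj₂ a≤0 = always λ n → ≤-<-trans a≤0 (exp-positive (s n))
      ... | inj₁ 0<a = eventually-map (λ la<s → <-respˡ-≈ (exp-ln 0<a) (exp-mono-< la<s))
        (⇝-above s⇝l (exp-cancel-< (<-respˡ-≈ (≈-sym (exp-ln 0<a)) a<el)))
      below : ∀ b → exp l < b → Eventually λ n → exp (s n) < b
      below b el<b = eventually-map (λ s<lb → <-respʳ-≈ (exp-ln 0<b) (exp-mono-< s<lb))
        (⇝-below s⇝l (exp-cancel-< (<-respʳ-≈ (≈-sym (exp-ln 0<b)) el<b)))
        where 0<b = <-trans (exp-positive l) el<b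

    ⇝-ln : ∀ {s l} → (∀ n → 0# < s n) → 0# < l → s ⇝ l → (λ n → ln (s n)) ⇝ ln l
    ⇝-ln {s} {l} 0<s 0<l s⇝l = ⇝-between
      (λ a a<ln → eventually-map (λ {n} ea<s → exp-cancel-< (<-respʳ-≈ (≈-sym (exp-ln (0<s n))) ea<s))
        (⇝-above s⇝l (<-respʳ-≈ (exp-ln 0<l) (exp-mono-< a<ln))))
      (λ b ln<b → eventually-map (λ {n} s<eb → exp-cancel-< (<-respˡ-≈ (≈-sym (exp-ln (0<s n))) s<eb))
        (⇝-below s⇝l (<-respˡ-≈ (exp-ln 0<l) (exp-mono-< ln<b))))

    -- Writing the inverse as `exp (- ln x)` reduces the claim to continuity of `exp` and `ln`.
    ⇝-⁻¹ : ∀ {s l} → (∀ n → 0# < s n) → 0# < l → s ⇝ l → (λ n → s n ⁻¹) ⇝ l ⁻¹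
    ⇝-⁻¹ {s} {l} 0<s 0<l s⇝l = ⇝-cong (λ n → inverse-exp (0<s n)) (inverse-exp 0<l)
      (⇝-exp (⇝-neg (⇝-ln 0<s 0<l s⇝l)))
      where
      inverse-exp : ∀ {x} → 0# < x → exp (- ln x) ≈ x ⁻¹
      inverse-exp {x} 0<x = ⁻¹-unique 0<x
        (≈-trans (*-congʳ (≈-sym (exp-ln 0<x))) (exp-neg (ln x)))

    ⇝-/ : ∀ {s t l k} → (∀ n → 0# < t n) → 0# < k → s ⇝ l → t ⇝ k → (λ n → s n / t n) ⇝ l / k
    ⇝-/ 0<t 0<k s⇝l t⇝k = ⇝-* s⇝l (⇝-⁻¹ 0<t 0<k t⇝k)

    ^ᴿ-positive : ∀ x a → 0# < x ^ᴿ a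
    ^ᴿ-positive x a = exp-positive (a * ln x)

    -- The product appears as any `z` equal to it, because `ln` selects its value by excluded middle
    -- and equal arguments are compared through `ln-unique`.
    ^ᴿ-* : ∀ {x y z} a → 0# < x → 0# < y → x * y ≈ z → (x ^ᴿ a) * (y ^ᴿ a) ≈ z ^ᴿ a
    ^ᴿ-* {x} {y} {z} a 0<x 0<y xy≈z = begin-equality
      exp (a * ln x) * exp (a * ln y)   ≈⟨ exp-+ _ _ ⟨
      exp (a * ln x + a * ln y)         ≈⟨ exp-cong (distribˡ a _ _) ⟨
      exp (a * (ln x + ln y))           ≈⟨ exp-cong (*-congˡ (ln-unique (begin-equality
        exp (ln x + ln y)         ≈⟨ exp-+ _ _ ⟩
        exp (ln x) * exp (ln y)   ≈⟨ *-cong (exp-ln 0<x) (exp-ln 0<y) ⟩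
        x * y                     ≈⟨ xy≈z ⟩
        z                         ∎))) ⟨
      exp (a * ln z)                    ∎

    ⇝-^ᴿ : ∀ {s l} a → (∀ n → 0# < s n) → 0# < l → s ⇝ l → (λ n → s n ^ᴿ a) ⇝ l ^ᴿ a
    ⇝-^ᴿ a 0<s 0<l s⇝l = ⇝-exp (⇝-* (⇝-const a) (⇝-ln 0<s 0<l s⇝l))

-- The exponential laws for the limit of (1 + x/n)ⁿ

module Exponential (em : ExcludedMiddle 0ℓ) (𝐑 : CompleteOrderedField) where
  open Real em 𝐑
  open OrderedField em 𝐑
  open Limits em 𝐑
  open ≤-Reasoning
  open ExponentialFunction em 𝐑
  open CommutativeSemiringExp commutativeSemiring using (^-distrib-*; ^-congˡ)

  base : ℝ → ℕ → ℝ
  base x n = 1# + x / fromℕ (suc n)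

  approx : ℝ → ℕ → ℝ
  approx x n = base x n ^ suc n

  -- For negative `x` the first bases can be negative, so the estimates on approximants are
  -- available only from some index on.
  base-positive : ∀ x → Eventually λ n → 0# < base x n
  base-positive x = ⇝-above
    (⇝-cong (λ _ → ≈-refl) (+-identityʳ 1#) (⇝-+ (⇝-const 1#) (null-*ˡ x reciprocal⇝0))) 0<1

  fromℕ*base : ∀ x n → fromℕ (suc n) * base x n ≈ fromℕ (suc n) + x
  fromℕ*base x n = begin-equality
    N * (1# + x * i)  ≈⟨ solve 3 (λ N x i → N :* (con 1ℤ :+ x :* i) := N :+ x :* (N :* i)) ≈-refl N x i ⟩
    N + x * (N * i)   ≈⟨ +-congˡ (*-congˡ (reciprocal-inverse n)) ⟩
    N + x * 1#        ≈⟨ +-congˡ (*-identityʳ x) ⟩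
    N + x             ∎
    where N = fromℕ (suc n); i = reciprocal n

  -- AM-GM applies with `a` and `b` two consecutive bases: n + 1 times the base at n is n + 1 + x,
  -- so the remaining weighted term is exactly 1.
  approx-increasing : ∀ x n → 0# < base x n → 0# < base x (suc n) → approx x n ≤ approx x (suc n)
  approx-increasing x n 0<u 0<v = begin
    approx x n                    ≈⟨ *-identityʳ _ ⟨
    approx x n * 1#               ≈⟨ *-congˡ tangent ⟨
    approx x n * (fromℕ (suc (suc n)) * base x (suc n) - fromℕ (suc n) * base x n)
                                  ≤⟨ am-gm (suc n) (inj₁ 0<u) (inj₁ 0<v) ⟩
    approx x (suc n)              ∎
    where
    tangent : fromℕ (suc (suc n)) * base x (suc n) - fromℕ (suc n) * base x n ≈ 1#
    tangent = ≈-trans (+-cong (fromℕ*base x (suc n)) (-‿cong (fromℕ*base x n)))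
      (solve 2 (λ N x → con 1ℤ :+ N :+ x :- (N :+ x) := con 1ℤ) ≈-refl (fromℕ (suc n)) x)

  approx*approx≤1 : ∀ x n → 0# < base x n → 0# < base (- x) n → approx x n * approx (- x) n ≤ 1#
  approx*approx≤1 x n 0<u 0<v = begin
    approx x n * approx (- x) n            ≈⟨ ^-distrib-* (base x n) (base (- x) n) (suc n) ⟨
    (base x n * base (- x) n) ^ suc n      ≤⟨ ^-≤1 (suc n) (inj₁ (*-positive 0<u 0<v)) (≤-by _
        (square-nonnegative (x / fromℕ (suc n)))
        (solve 2 (λ x i → con 1ℤ :- (con 1ℤ :+ x :* i) :* (con 1ℤ :+ (:- x) :* i) := (x :* i) :* (x :* i))
          ≈-refl x (reciprocal n))) ⟩
    1#                                     ∎

  -- The approximants of `x` increase; those of `- x` increase as well and the products are at most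
  -- 1, so the inverse of a single approximant of `- x` bounds the former.
  approx-converges : ∀ x → ∃ (approx x ⇝_)
  approx-converges x =
    monotone-convergence {approx x} {b ⁻¹} N (increasing x (λ n N≤n → proj₁ (positive n N≤n))) upper
    where
    eventually = eventually-× (base-positive x) (base-positive (- x))
    N = proj₁ eventually
    positive = proj₂ eventually
    increasing : ∀ y → (∀ n → N ℕ.≤ n → 0# < base y n) → ∀ n → N ℕ.≤ n → approx y n ≤ approx y (suc n)
    increasing y 0<u n N≤n = approx-increasing y n (0<u n N≤n) (0<u (suc n) (ℕₚ.m≤n⇒m≤1+n N≤n))
    b = approx (- x) N
    0<b = ^-positive (suc N) (proj₂ (positive N ℕₚ.≤-refl))
    upper : ∀ n → N ℕ.≤ n → approx x n ≤ b ⁻¹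
    upper n N≤n = *-cancelˡ-≤ b 0<b (begin
      b * approx x n               ≈⟨ *-comm b _ ⟩
      approx x n * b               ≤⟨ *-monoʳ-≤ _ (^-nonnegative (suc n) (inj₁ (proj₁ (positive n N≤n))))
                                        (steps⇒monotone (approx (- x)) (increasing (- x) (λ n N≤n → proj₂ (positive n N≤n)))
                                          ℕₚ.≤-refl (ℕₚ.≤⇒≤′ N≤n)) ⟩
      approx x n * approx (- x) n  ≤⟨ approx*approx≤1 x n (proj₁ (positive n N≤n)) (proj₂ (positive n N≤n)) ⟩
      1#                           ≈⟨ ⁻¹-inverseʳ (positive⇒≉0 0<b) ⟨
      b * b ⁻¹                     ∎)

  approx⇝exp : ∀ x → approx x ⇝ exp x
  approx⇝exp x = let l , approx⇝l = approx-converges x in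
    ⇝-cong (λ _ → ≈-refl) (≈-sym (lim-≈ approx⇝l)) approx⇝l

  exp-cong : ∀ {x y} → x ≈ y → exp x ≈ exp y
  exp-cong {x} {y} x≈y = ⇝-unique (approx⇝exp x)
    (⇝-cong (λ n → ^-congˡ (suc n) (+-congˡ (*-congʳ (≈-sym x≈y)))) ≈-refl (approx⇝exp y))

  exp-nonnegative : ∀ x → 0# ≤ exp x
  exp-nonnegative x = ⇝-≤ (⇝-const 0#) (approx⇝exp x)
    (eventually-map (λ {n} 0<u → ^-nonnegative (suc n) (inj₁ 0<u)) (base-positive x))

  exp0≈1 : exp 0# ≈ 1#
  exp0≈1 = ⇝-unique (approx⇝exp 0#) (⇝-cong
    (λ n → ≈-trans (≈-sym (1^n≈1 (suc n)))
      (^-congˡ (suc n) (solve 1 (λ i → con 1ℤ := con 1ℤ :+ con 0ℤ :* i) ≈-refl (reciprocal n))))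
    ≈-refl (⇝-const 1#))

  1+x≤exp : ∀ x → 1# + x ≤ exp x
  1+x≤exp x = ⇝-≤ (⇝-const (1# + x)) (approx⇝exp x) (eventually-map
    (λ {n} 0<u → ≤-trans (inj₂ (begin-equality
        1# + x                                   ≈⟨ solve 2 (λ x N → con 1ℤ :+ x := con 1ℤ :+ ((N :+ x) :- N)) ≈-refl x (fromℕ (suc n)) ⟩
        1# + ((fromℕ (suc n) + x) - fromℕ (suc n)) ≈⟨ +-congˡ (+-congʳ (fromℕ*base x n)) ⟨
        1# + (fromℕ (suc n) * base x n - fromℕ (suc n))
          ≈⟨ solve 2 (λ b N → con 1ℤ :+ (N :* b :- N) := con 1ℤ :+ N :* (b :- con 1ℤ)) ≈-refl (base x n) (fromℕ (suc n)) ⟩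
        1# + fromℕ (suc n) * (base x n - 1#)     ∎))
      (bernoulli n (inj₁ 0<u)))
    (base-positive x))

  -- The first-order term of the product is `x + y + z`, and what is left carries a factor `i`. The
  -- solver cannot use hypotheses, so `0#` and `1#` are first inserted and then replaced by
  -- `x + y + z` and `N * i`.
  expand : ∀ x y z N i → x + y + z ≈ 0# → N * i ≈ 1# →
    1# + ((x * y + y * z + z * x) * i + x * y * z * (i * i)) ≈
    1# + N * ((1# + x * i) * (1# + y * i) * (1# + z * i) - 1#)
  expand x y z N i x+y+z≈0 Ni≈1 = begin-equality
    1# + (c * i + d * (i * i))
      ≈⟨ solve 3 (λ i c d → con 1ℤ :+ (c :* i :+ d :* (i :* i)) :=
                            con 1ℤ :+ con 1ℤ :* (con 0ℤ :+ c :* i :+ d :* (i :* i))) ≈-refl i c d ⟩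
    1# + 1# * (0# + c * i + d * (i * i))
      ≈⟨ +-congˡ (*-cong Ni≈1 (+-congʳ (+-congʳ x+y+z≈0))) ⟨
    1# + N * i * (x + y + z + c * i + d * (i * i))
      ≈⟨ solve 5 (λ N i x y z →
           con 1ℤ :+ N :* i :* (x :+ y :+ z :+ (x :* y :+ y :* z :+ z :* x) :* i :+ x :* y :* z :* (i :* i)) :=
           con 1ℤ :+ N :* ((con 1ℤ :+ x :* i) :* (con 1ℤ :+ y :* i) :* (con 1ℤ :+ z :* i) :- con 1ℤ))
           ≈-refl N i x y z ⟩
    1# + N * ((1# + x * i) * (1# + y * i) * (1# + z * i) - 1#) ∎
    where
    c = x * y + y * z + z * x
    d = x * y * z

  -- Bernoulli's inequality on the product of the three approximants, whose bases multiply to 1 + O(1/n²).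
  exp-triple : ∀ x y z → x + y + z ≈ 0# → 1# ≤ exp x * exp y * exp z
  exp-triple x y z x+y+z≈0 = ⇝-≤ lower
    (⇝-* (⇝-* (approx⇝exp x) (approx⇝exp y)) (approx⇝exp z))
    (eventually-map (λ {n} → estimate n)
      (eventually-× (eventually-× (base-positive x) (base-positive y)) (base-positive z)))
    where
    c = x * y + y * z + z * x
    d = x * y * z
    lower : (λ n → 1# + (c * reciprocal n + d * (reciprocal n * reciprocal n))) ⇝ 1#
    lower = ⇝-cong (λ _ → ≈-refl) (solve 0 (con 1ℤ :+ (con 0ℤ :+ con 0ℤ) := con 1ℤ) ≈-refl)
      (⇝-+ (⇝-const 1#) (⇝-+ (null-*ˡ c reciprocal⇝0) (null-*ˡ d (null-* reciprocal⇝0 reciprocal⇝0))))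
    estimate : ∀ n → (0# < base x n × 0# < base y n) × 0# < base z n →
               1# + (c * reciprocal n + d * (reciprocal n * reciprocal n)) ≤
               approx x n * approx y n * approx z n
    estimate n ((0<u , 0<v) , 0<w) = begin
      1# + (c * reciprocal n + d * (reciprocal n * reciprocal n))
        ≈⟨ expand x y z (fromℕ (suc n)) (reciprocal n) x+y+z≈0 (reciprocal-inverse n) ⟩
      1# + fromℕ (suc n) * (base x n * base y n * base z n - 1#)
        ≤⟨ bernoulli n (inj₁ (*-positive (*-positive 0<u 0<v) 0<w)) ⟩
      (base x n * base y n * base z n) ^ suc n
        ≈⟨ ^-distrib-* (base x n * base y n) (base z n) (suc n) ⟩
      (base x n * base y n) ^ suc n * approx z n
        ≈⟨ *-congʳ (^-distrib-* (base x n) (base y n) (suc n)) ⟩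
      approx x n * approx y n * approx z n ∎

  exp-neg : ∀ x → exp x * exp (- x) ≈ 1#
  exp-neg x = ≤-antisym
    (⇝-≤ (⇝-* (approx⇝exp x) (approx⇝exp (- x))) (⇝-const 1#)
      (eventually-map (λ {n} (0<u , 0<v) → approx*approx≤1 x n 0<u 0<v)
        (eventually-× (base-positive x) (base-positive (- x)))))
    (begin
      1#                          ≤⟨ exp-triple x (- x) 0# (solve 1 (λ x → x :+ :- x :+ con 0ℤ := con 0ℤ) ≈-refl x) ⟩
      exp x * exp (- x) * exp 0#  ≈⟨ *-congˡ exp0≈1 ⟩
      exp x * exp (- x) * 1#      ≈⟨ *-identityʳ _ ⟩
      exp x * exp (- x)           ∎)

  exp-positive : ∀ x → 0# < exp x
  exp-positive x = ≤∧≉⇒< (exp-nonnegative x) λ 0≈e → <-irrefl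
    (≈-trans (≈-sym (zeroˡ (exp (- x)))) (≈-trans (*-congʳ 0≈e) (exp-neg x))) 0<1

  exp-+ : ∀ x y → exp (x + y) ≈ exp x * exp y
  exp-+ x y = *-cancelˡ-≈ (exp (- (x + y))) (exp-positive _) (begin-equality
    exp (- (x + y)) * exp (x + y)        ≈⟨ *-comm _ _ ⟩
    exp (x + y) * exp (- (x + y))        ≈⟨ exp-neg (x + y) ⟩
    1#                                   ≈⟨ ≤-antisym (exp-triple x y (- (x + y)) x+y-[x+y]≈0) A≤1 ⟩
    exp x * exp y * exp (- (x + y))      ≈⟨ *-comm _ _ ⟩
    exp (- (x + y)) * (exp x * exp y)    ∎)
    where
    -- `A` and `B` are inverse to each other and both at least 1, hence both equal to 1.
    A = exp x * exp y * exp (- (x + y))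
    B = exp (- x) * exp (- y) * exp (x + y)
    x+y-[x+y]≈0 : x + y - (x + y) ≈ 0#
    x+y-[x+y]≈0 = -‿inverseʳ (x + y)
    1≤B : 1# ≤ B
    1≤B = exp-triple (- x) (- y) (x + y) (solve 2 (λ x y → :- x :+ :- y :+ (x :+ y) := con 0ℤ) ≈-refl x y)
    AB≈1 : A * B ≈ 1#
    AB≈1 = begin-equality
      A * B ≈⟨ solve 6 (λ a b c a′ b′ c′ → (a :* b :* c′) :* (a′ :* b′ :* c) := (a :* a′) :* (b :* b′) :* (c :* c′))
                 ≈-refl (exp x) (exp y) (exp (x + y)) (exp (- x)) (exp (- y)) (exp (- (x + y))) ⟩
      (exp x * exp (- x)) * (exp y * exp (- y)) * (exp (x + y) * exp (- (x + y)))
            ≈⟨ *-cong (*-cong (exp-neg x) (exp-neg y)) (exp-neg (x + y)) ⟩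
      1# * 1# * 1# ≈⟨ solve 0 (con 1ℤ :* con 1ℤ :* con 1ℤ := con 1ℤ) ≈-refl ⟩
      1# ∎
    A≤1 : A ≤ 1#
    A≤1 = begin
      A      ≈⟨ *-identityʳ A ⟨
      A * 1# ≤⟨ *-monoʳ-≤ A (inj₁ (*-positive (*-positive (exp-positive x) (exp-positive y)) (exp-positive _))) 1≤B ⟩
      A * B  ≈⟨ AB≈1 ⟩
      1#     ∎

  isExponential : IsExponential exp
  isExponential = record
    { exp-cong = exp-cong ; exp-positive = exp-positive ; exp-+ = exp-+
    ; exp-neg = exp-neg ; 1+x≤exp = 1+x≤exp }

  exp-ln : ∀ {y} → 0# < y → exp (ln y) ≈ y
  exp-ln {y} 0<y with em {∃ λ x → exp x ≈ y}
  ... | yes (x , ex≈y) = ex≈y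
  ... | no  none       = contradiction (IsExponential.exp-surjective isExponential 0<y) none

-- Calculus of exponential asymptotics

module Asymptotics (em : ExcludedMiddle 0ℓ) (𝐑 : CompleteOrderedField) where
  open Real em 𝐑 hiding (exp; ln; _^ᴿ_)
  open OrderedField em 𝐑
  open Limits em 𝐑
  open ExponentialFunction em 𝐑
  open ≤-Reasoning
  open MonoidSum +-commutativeMonoid using (sum)
  open MonoidSum (AbelianGroup.commutativeMonoid ℝ₊*) using () renaming (sum to product)

  module AsymptoticCalculus {exp : ℝ → ℝ} (isExponential : IsExponential exp) where
    open IsExponential isExponential

    -- a ~[ g ] l says a = exp (g l + o(g)), with the error term written as g (s - l).
    infix 4 _~[_]_
    _~[_]_ : (ℕ → ℝ) → (ℕ → ℝ) → ℝ → Set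
    a ~[ g ] l = ∃ λ s → s ⇝ l × (∀ m → a m ≈ exp (g m * s m))

    asymptotic-o : ∀ {g a l r} → (∀ m → 0# < g m) → r ∈o g →
                   (∀ m → a m ≈ exp (g m * l + r m)) → a ~[ g ] l
    asymptotic-o {g} {a} {l} {r} 0<g r∈o a≈ = (λ m → l + r m / g m) ,
      ⇝-cong (λ _ → ≈-refl) (+-identityʳ l) (⇝-+ (⇝-const l) r∈o) ,
      λ m → ≈-trans (a≈ m) (exp-cong (begin-equality
        g m * l + r m               ≈⟨ +-congˡ (/-cancel (r m) (0<g m)) ⟨
        g m * l + r m / g m * g m   ≈⟨ solve 3 (λ g l q → g :* l :+ q :* g := g :* (l :+ q)) ≈-refl (g m) l (r m / g m) ⟩
        g m * (l + r m / g m)       ∎))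

    asymptotic-cong : ∀ {g h a b l} → (∀ m → g m ≈ h m) → (∀ m → a m ≈ b m) → a ~[ g ] l → b ~[ h ] l
    asymptotic-cong g≈h a≈b (s , s⇝l , a≈) = s , s⇝l , λ m →
      ≈-trans (≈-sym (a≈b m)) (≈-trans (a≈ m) (exp-cong (*-congʳ (g≈h m))))

    -- Injectivity of `exp` and positivity of `g` force the two normalised exponents to coincide
    -- term by term.
    asymptotic-unique : ∀ {g a l k} → (∀ m → 0# < g m) → a ~[ g ] l → a ~[ g ] k → l ≈ k
    asymptotic-unique {g} 0<g (s , s⇝l , a≈s) (t , t⇝k , a≈t) = ⇝-unique s⇝l (⇝-cong
      (λ m → *-cancelˡ-≈ (g m) (0<g m) (exp-injective (≈-trans (≈-sym (a≈t m)) (a≈s m)))) ≈-refl t⇝k)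

    -- Passes from the mass of a conditioned counting function to the full mass; `c` will be
    -- (Y_*p(y))^α.
    asymptotic-rescale : ∀ {g h a l t c} → (∀ m → h m ≈ g m * t m) → t ⇝ c → a ~[ h ] l → a ~[ g ] c * l
    asymptotic-rescale {g} {t = t} h≈gt t⇝c (s , s⇝l , a≈) = (λ m → t m * s m) , ⇝-* t⇝c s⇝l ,
      λ m → ≈-trans (a≈ m) (exp-cong (≈-trans (*-congʳ (h≈gt m)) (*-assoc (g m) (t m) (s m))))

    asymptotic-* : ∀ {g a b l k} → a ~[ g ] l → b ~[ g ] k → (λ m → a m * b m) ~[ g ] l + k
    asymptotic-* {g} (s , s⇝l , a≈) (t , t⇝k , b≈) = (λ m → s m + t m) , ⇝-+ s⇝l t⇝k , λ m →
      ≈-trans (*-cong (a≈ m) (b≈ m))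
        (≈-trans (≈-sym (exp-+ _ _)) (exp-cong (≈-sym (distribˡ (g m) (s m) (t m)))))

    asymptotic-⁻¹ : ∀ {g a l} → a ~[ g ] l → (λ m → a m ⁻¹) ~[ g ] - l
    asymptotic-⁻¹ {g} {a} (s , s⇝l , a≈) = (λ m → - s m) , ⇝-neg s⇝l , λ m →
      ≈-sym (⁻¹-unique (<-respʳ-≈ (≈-sym (a≈ m)) (exp-positive (g m * s m))) (begin-equality
        a m * exp (g m * - s m)               ≈⟨ *-cong (a≈ m) (exp-cong (solve 2 (λ g s → g :* (:- s) := :- (g :* s)) ≈-refl (g m) (s m))) ⟩
        exp (g m * s m) * exp (- (g m * s m)) ≈⟨ exp-neg (g m * s m) ⟩
        1#                                    ∎))

    asymptotic-1 : ∀ {g} → (λ _ → 1#) ~[ g ] 0#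
    asymptotic-1 {g} = (λ _ → 0#) , ⇝-const 0# , λ m → begin-equality
      -- The value of `exp` at zero is not among the laws; it comes from `exp-neg` at zero.
      1#              ≈⟨ exp-neg 0# ⟨
      exp 0# * exp (- 0#) ≈⟨ exp-+ 0# (- 0#) ⟨
      exp (0# + - 0#) ≈⟨ exp-cong (solve 1 (λ g → con 0ℤ :- con 0ℤ := g :* con 0ℤ) ≈-refl (g m)) ⟩
      exp (g m * 0#)  ∎

    asymptotic-product : ∀ {n g} {a : Fin n → ℕ → ∃ (0# <_)} {l : Fin n → ℝ} →
                         (∀ i → (λ m → proj₁ (a i m)) ~[ g ] l i) →
                         (λ m → proj₁ (product (λ i → a i m))) ~[ g ] sum l
    asymptotic-product {zero}  a~l = asymptotic-1
    asymptotic-product {suc n} a~l = asymptotic-* (a~l zero) (asymptotic-product (a~l ∘ suc))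

-- Counting functions approximating a probability

module Approximation (em : ExcludedMiddle 0ℓ) (𝐑 : CompleteOrderedField) (𝐒 : InformationStructure) where
  open Cohomology em 𝐑 𝐒
  open OrderedField em 𝐑
  open Limits em 𝐑
  open ExponentialFunction em 𝐑 using (module Logarithm)
  open Exponential em 𝐑 using (isExponential; exp-ln)
  open Logarithm isExponential exp-ln using (⇝-/)
  open ≤-Reasoning
  open MonoidSum ℕₚ.+-0-commutativeMonoid using () renaming (sum to sumℕ)
  open MonoidSum +-commutativeMonoid using (sum)
  open SemiringSum semiring using (*-distribʳ-sum; *-distribˡ-sum)

  fromℕ-sum : ∀ {n} (f : Fin n → ℕ) → fromℕ (sumℕ f) ≈ sum (fromℕ ∘ f)
  fromℕ-sum {zero}  f = ≈-refl
  fromℕ-sum {suc n} f = ≈-trans (fromℕ-+ (f zero) _) (+-congˡ (fromℕ-sum (f ∘ suc)))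

  sum-mono-≤ : ∀ {n} {f g : Fin n → ℝ} → (∀ i → f i ≤ g i) → sum f ≤ sum g
  sum-mono-≤ {zero}  f≤g = inj₂ ≈-refl
  sum-mono-≤ {suc n} f≤g = +-mono-≤ (f≤g zero) (sum-mono-≤ (f≤g ∘ suc))

  -- The tolerance `δ` is fixed before `f` and `g`: this uniformity makes preimages of open sets
  -- under marginalisation open.
  Close-sum : ∀ n {ε} → 0# < ε → ∃ λ δ → 0# < δ ×
              (∀ {f g : Fin n → ℝ} → (∀ i → Close δ (f i) (g i)) → Close ε (sum f) (sum g))
  Close-sum zero    {ε} 0<ε = ε , 0<ε , λ _ → x<x+ε 0# 0<ε , x<x+ε 0# 0<ε
  Close-sum (suc n) {ε} 0<ε with half 0<ε
  ... | δ , 0<δ , 2δ≈ε with Close-sum n 0<δ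
  ...   | δ′ , 0<δ′ , close-sum with <-≤-total δ δ′
  ...     | inj₁ δ<δ′ = δ , 0<δ , λ close →
    Close-resp 2δ≈ε (Close-+ (close zero) (close-sum λ i → Close-mono (inj₁ δ<δ′) (close (suc i))))
  ...     | inj₂ δ′≤δ = δ′ , 0<δ′ , λ close →
    Close-resp 2δ≈ε (Close-+ (Close-mono δ′≤δ (close zero)) (close-sum (close ∘ suc)))

  -- The relation is arbitrary so that one case distinction serves equality, nonnegativity and
  -- closeness.
  onFibre-lift : ∀ {X Y} (π : X ⟶ Y) (R : ℝ → ℝ → Set) {f g : E X → ℝ} y →
                 R 0# 0# → (∀ x → R (f x) (g x)) → ∀ x → R (Σℝ.onFibre π f y x) (Σℝ.onFibre π g y x)
  onFibre-lift π R y R00 Rfg x with does (E₁ π x ≟ᴱ y)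
  ... | true  = Rfg x
  ... | false = R00

  marginal-cong : ∀ {X Y} (π : X ⟶ Y) {f g : E X → ℝ} y → (∀ x → f x ≈ g x) →
                  Σℝ.marginal π f y ≈ Σℝ.marginal π g y
  marginal-cong {X} π y f≈g = Σℝ.∑-cong X (onFibre-lift π _≈_ y ≈-refl f≈g)

  fromℕ-onFibre : ∀ {X Y} (π : X ⟶ Y) (f : E X → ℕ) y x →
                  fromℕ (Σℕ.onFibre π f y x) ≈ Σℝ.onFibre π (fromℕ ∘ f) y x
  fromℕ-onFibre π f y x with does (E₁ π x ≟ᴱ y)
  ... | true  = ≈-refl
  ... | false = ≈-refl

  onFibre-/ : ∀ {X Y} (π : X ⟶ Y) (f : E X → ℝ) c y x →
              Σℝ.onFibre π f y x / c ≈ Σℝ.onFibre π (λ x → f x / c) y x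
  onFibre-/ π f c y x with does (E₁ π x ≟ᴱ y)
  ... | true  = ≈-refl
  ... | false = zeroˡ _

  onFibre-⇝ : ∀ {X Y} (π : X ⟶ Y) (s : E X → ℕ → ℝ) (l : E X → ℝ) y → (∀ x → s x ⇝ l x) → ∀ x →
              (λ m → Σℝ.onFibre π (λ x → s x m) y x) ⇝ Σℝ.onFibre π l y x
  onFibre-⇝ π s l y s⇝l x with does (E₁ π x ≟ᴱ y)
  ... | true  = s⇝l x
  ... | false = ⇝-const 0#

  -- The denominator is left free: it is the mass for a given sequence, but m + 1 for the rounded
  -- counts.
  onFibre-ratio-⇝ : ∀ {X Y} (π : X ⟶ Y) (ν : ℕ → E X → ℕ) (c : ℕ → ℝ) (l : E X → ℝ) y →
                    (∀ x → (λ m → fromℕ (ν m x) / c m) ⇝ l x) →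
                    ∀ x → (λ m → fromℕ (Σℕ.onFibre π (ν m) y x) / c m) ⇝ Σℝ.onFibre π l y x
  onFibre-ratio-⇝ π ν c l y ν⇝l x = ⇝-cong
    (λ m → ≈-sym (≈-trans (*-congʳ (fromℕ-onFibre π (ν m) y x)) (onFibre-/ π (fromℕ ∘ ν m) (c m) y x)))
    ≈-refl (onFibre-⇝ π (λ x m → fromℕ (ν m x) / c m) l y ν⇝l x)

  ∑-ratio-⇝ : ∀ X (ν : ℕ → E X → ℕ) (c : ℕ → ℝ) (l : E X → ℝ) →
              (∀ x → (λ m → fromℕ (ν m x) / c m) ⇝ l x) →
              (λ m → fromℕ (Σℕ.∑ X (ν m)) / c m) ⇝ Σℝ.∑ X l
  ∑-ratio-⇝ X ν c l ν⇝l = ⇝-cong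
    (λ m → ≈-sym (≈-trans (*-congʳ (fromℕ-sum (ν m ∘ Σℕ.enumerate X)))
                          (*-distribʳ-sum (c m ⁻¹) (fromℕ ∘ ν m ∘ Σℝ.enumerate X))))
    ≈-refl (⇝-sum (λ i → ν⇝l (Σℝ.enumerate X i)))

  marginal-ratio-⇝ : ∀ {X Y} (π : X ⟶ Y) (ν : ℕ → E X → ℕ) (c : ℕ → ℝ) (l : E X → ℝ) y →
                     (∀ x → (λ m → fromℕ (ν m x) / c m) ⇝ l x) →
                     (λ m → fromℕ (Σℕ.marginal π (ν m) y) / c m) ⇝ Σℝ.marginal π l y
  marginal-ratio-⇝ {X} π ν c l y ν⇝l =
    ∑-ratio-⇝ X (λ m → Σℕ.onFibre π (ν m) y) c (Σℝ.onFibre π l y) (onFibre-ratio-⇝ π ν c l y ν⇝l)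

  ∑-scaled-≤ : ∀ X t (f : E X → ℝ) (k : E X → ℕ) → (∀ x → t * f x ≤ fromℕ (k x)) →
               t * Σℝ.∑ X f ≤ fromℕ (Σℕ.∑ X k)
  ∑-scaled-≤ X t f k tf≤k = begin
    t * Σℝ.∑ X f                            ≈⟨ *-distribˡ-sum t (f ∘ Σℝ.enumerate X) ⟩
    Σℝ.∑ X (λ x → t * f x)                  ≤⟨ sum-mono-≤ (λ i → tf≤k (Σℝ.enumerate X i)) ⟩
    Σℝ.∑ X (fromℕ ∘ k)                      ≈⟨ fromℕ-sum (k ∘ Σℕ.enumerate X) ⟨
    fromℕ (Σℕ.∑ X k)                        ∎

  marginal-scaled-≤ : ∀ {X Y} (π : X ⟶ Y) t (f : E X → ℝ) (k : E X → ℕ) y →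
                      (∀ x → t * f x ≤ fromℕ (k x)) →
                      t * Σℝ.marginal π f y ≤ fromℕ (Σℕ.marginal π k y)
  marginal-scaled-≤ {X} π t f k y tf≤k = ∑-scaled-≤ X t (Σℝ.onFibre π f y) (Σℕ.onFibre π k y) on
    where
    on : ∀ x → t * Σℝ.onFibre π f y x ≤ fromℕ (Σℕ.onFibre π k y x)
    on x with does (E₁ π x ≟ᴱ y)
    ... | true  = tf≤k x
    ... | false = inj₂ (zeroʳ t)

  marginal-zero : ∀ {X Y} (π : X ⟶ Y) (k : E X → ℕ) y → (∀ x → E₁ π x ≡ y → k x ≡ 0) →
                  Σℕ.marginal π k y ≡ 0
  marginal-zero {X} π k y k≡0 = sum-zero _ λ i → on (Σℕ.enumerate X i)
    where
    sum-zero : ∀ {n} (f : Fin n → ℕ) → (∀ i → f i ≡ 0) → sumℕ f ≡ 0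
    sum-zero {zero}  f f≡0 = ≡.refl
    sum-zero {suc n} f f≡0 = ≡.cong₂ ℕ._+_ (f≡0 zero) (sum-zero (f ∘ suc) (f≡0 ∘ suc))
    on : ∀ x → Σℕ.onFibre π k y x ≡ 0
    on x with E₁ π x ≟ᴱ y
    ... | yes πx≡y = ≡.trans (Σℕ.onFibre-∈ π k πx≡y) (k≡0 x πx≡y)
    ... | no  πx≢y = Σℕ.onFibre-∉ π k πx≢y

  sum-nonnegative : ∀ {n} {f : Fin n → ℝ} → (∀ i → 0# ≤ f i) → 0# ≤ sum f
  sum-nonnegative {zero}  0≤f = inj₂ ≈-refl
  sum-nonnegative {suc n} 0≤f = +-nonnegative (0≤f zero) (sum-nonnegative (0≤f ∘ suc))

  term≤sum : ∀ {n} {f : Fin n → ℝ} → (∀ i → 0# ≤ f i) → ∀ i → f i ≤ sum f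
  term≤sum {f = f} 0≤f zero = ≤-trans (inj₂ (≈-sym (+-identityʳ (f zero))))
    (+-mono-≤ (inj₂ ≈-refl) (sum-nonnegative (0≤f ∘ suc)))
  term≤sum {f = f} 0≤f (suc i) = ≤-trans (inj₂ (≈-sym (+-identityˡ (f (suc i)))))
    (+-mono-≤ (0≤f zero) (term≤sum (0≤f ∘ suc) i))

  -- Consequently `p` vanishes at every point of a fibre of probability zero, and so do the rounded
  -- counts.
  prob≤marginal : ∀ {X Y} (π : X ⟶ Y) (p : 𝒫 X) x → prob p x ≤ prob (push-𝒫 π p) (E₁ π x)
  prob≤marginal {X} π p x = begin
    prob p x                              ≡⟨ Σℝ.onFibre-∈ π (prob p) ≡.refl ⟨
    fibre x                               ≡⟨ ≡.cong fibre (strictlyInverseʳ x) ⟨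
    fibre (Σℝ.enumerate X (to x))         ≤⟨ term≤sum (λ i → fibre-nonnegative (Σℝ.enumerate X i)) (to x) ⟩
    prob (push-𝒫 π p) (E₁ π x)            ∎
    where
    open Inverse (proj₂ (finite X)) using (to; strictlyInverseʳ)
    fibre = Σℝ.onFibre π (prob p) (E₁ π x)
    fibre-nonnegative : ∀ z → 0# ≤ fibre z
    fibre-nonnegative z = onFibre-lift π (λ _ → 0# ≤_) {prob p} (E₁ π x) (inj₂ ≈-refl) (nonnegative p) z

  Unbounded : (ℕ → ℕ) → Set
  Unbounded k = ∀ K → ∃ λ N → ∀ m → N ℕ.≤ m → K ℕ.≤ k m

  linear⇒unbounded : ∀ {s} {k : ℕ → ℕ} → 0# < s → (∀ m → fromℕ (suc m) * s ≤ fromℕ (k m)) → Unbounded k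
  linear⇒unbounded {s} {k} 0<s linear K with archimedean (fromℕ K / s)
  ... | N , K/s<N = N , λ m N≤m → fromℕ-cancel-≤ (begin
    fromℕ K             ≈⟨ /-cancel (fromℕ K) 0<s ⟨
    fromℕ K / s * s     ≈⟨ *-comm _ s ⟩
    s * (fromℕ K / s)   ≤⟨ *-monoʳ-≤ s (inj₁ 0<s) (inj₁ K/s<N) ⟩
    s * fromℕ N         ≤⟨ *-monoʳ-≤ s (inj₁ 0<s) (fromℕ-mono-≤ (ℕₚ.m≤n⇒m≤1+n N≤m)) ⟩
    s * fromℕ (suc m)   ≈⟨ *-comm s _ ⟩
    fromℕ (suc m) * s   ≤⟨ linear m ⟩
    fromℕ (k m)         ∎)

  linear⇒positive : ∀ {s} {k : ℕ → ℕ} → 0# < s → (∀ m → fromℕ (suc m) * s ≤ fromℕ (k m)) → ∀ m → 0 ℕ.< k m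
  linear⇒positive {k = k} 0<s linear m = ℕₚ.n≢0⇒n>0 λ k≡0 → ≤⇒≯ (linear m)
    (<-respˡ-≈ (reflexive (≡.cong fromℕ (≡.sym k≡0))) (*-positive (fromℕ-suc-positive m) 0<s))

  infix 4 _↝_
  _↝_ : ∀ {X} → (ℕ → 𝒞 X) → 𝒫 X → Set
  ν ↝ p = ∀ z → (λ m → fromℕ (count (ν m) z) / fromℕ ∥ ν m ∥) ⇝ prob p z

  push-∥∥ : ∀ {X Y} (π : X ⟶ Y) (ν : 𝒞 X) → ∥ push-𝒞 π ν ∥ ≡ ∥ ν ∥
  push-∥∥ π ν = Σℕ.∑-marginal π (count ν)

  push-↝ : ∀ {X Y} (π : X ⟶ Y) (ν : ℕ → 𝒞 X) (p : 𝒫 X) → ν ↝ p → (push-𝒞 π ∘ ν) ↝ push-𝒫 π p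
  push-↝ π ν p ν↝p y = ⇝-cong
    (λ m → *-congˡ (reflexive (≡.cong (λ k → fromℕ k ⁻¹) (≡.sym (push-∥∥ π (ν m))))))
    ≈-refl (marginal-ratio-⇝ π (count ∘ ν) (λ m → fromℕ ∥ ν m ∥) (prob p) y ν↝p)

  ∥∥-positive : ∀ {X} (ν : 𝒞 X) → 0# < fromℕ ∥ ν ∥
  ∥∥-positive ν = fromℕ-positive (positive ν)

  -- Here `t` is a common yardstick, namely m + 1. Counts and masses are each compared with it,
  -- which yields both the frequencies and the conditional frequencies.
  ratio-⇝ : ∀ {a b t : ℕ → ℝ} {x y} → (∀ m → 0# < b m) → (∀ m → 0# < t m) → 0# < y →
            (λ m → a m / t m) ⇝ x → (λ m → b m / t m) ⇝ y → (λ m → a m / b m) ⇝ x / y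
  ratio-⇝ {a} {b} {t} 0<b 0<t 0<y a/t⇝x b/t⇝y = ⇝-cong
    (λ m → *-cancelˡ-≈ (b m) (0<b m) (begin-equality
      b m * (a m / t m / (b m / t m))             ≈⟨ *-congʳ (/-cancel (b m) (0<t m)) ⟨
      b m / t m * t m * (a m / t m / (b m / t m)) ≈⟨ solve 4 (λ q t r w → q :* t :* (r :* w) := (w :* q) :* (r :* t))
                                                       ≈-refl (b m / t m) (t m) (a m / t m) ((b m / t m) ⁻¹) ⟩
      (b m / t m) ⁻¹ * (b m / t m) * (a m / t m * t m) ≈⟨ *-cong (⁻¹-inverseˡ (0<b/t m)) (/-cancel (a m) (0<t m)) ⟩
      1# * a m                                    ≈⟨ *-identityˡ (a m) ⟩
      a m                                         ≈⟨ /-cancel (a m) (0<b m) ⟨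
      a m / b m * b m                             ≈⟨ *-comm _ _ ⟩
      b m * (a m / b m)                           ∎))
    ≈-refl (⇝-/ 0<b/t 0<y a/t⇝x b/t⇝y)
    where
    0<b/t : ∀ m → 0# < b m / t m
    0<b/t m = *-positive (0<b m) (⁻¹-positive (0<t m))

  x/1≈x : ∀ x → x / 1# ≈ x
  x/1≈x x = ≈-trans (≈-sym (*-identityʳ _)) (/-cancel x 0<1)

  -- q = p|_{Y=y} in division-free form, so that the division by Y_*p(y) inside condition-𝒫 does not
  -- get in the way of deciding whether Y_*p(y) vanishes.
  IsConditional : ∀ {X Y} → X ⟶ Y → 𝒫 X → E Y → 𝒫 X → Set
  IsConditional π p y q = ∀ x → prob q x * prob (push-𝒫 π p) y ≈ Σℝ.onFibre π (prob p) y x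

  condition-isConditional : ∀ {X Y} (π : X ⟶ Y) (p : 𝒫 X) y (s≉0 : ¬ prob (push-𝒫 π p) y ≈ 0#) →
                            IsConditional π p y (condition-𝒫 π p y s≉0)
  condition-isConditional π p y s≉0 x = ≈-trans (*-congʳ (≈-sym (onFibre-/ π (prob p) _ y x)))
    (/-cancel _ (≤∧≉⇒< (nonnegative (push-𝒫 π p) y) (λ 0≈s → s≉0 (≈-sym 0≈s))))

  -- Rounding up, rather than down, keeps the counts positive exactly where p is.
  module Approximant {X} (p : 𝒫 X) where
    private
      scaled-nonnegative : ∀ m x → 0# ≤ fromℕ (suc m) * prob p x
      scaled-nonnegative m x = *-nonnegative (fromℕ-nonnegative (suc m)) (nonnegative p x)

      rounded : ℕ → E X → ℕ
      rounded m x = proj₁ (ceiling (scaled-nonnegative m x))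

      rounded-≥ : ∀ m x → fromℕ (suc m) * prob p x ≤ fromℕ (rounded m x)
      rounded-≥ m x = proj₁ (proj₂ (ceiling (scaled-nonnegative m x)))

      rounded-< : ∀ m x → fromℕ (rounded m x) < fromℕ (suc m) * prob p x + 1#
      rounded-< m x = proj₂ (proj₂ (ceiling (scaled-nonnegative m x)))

      total-≥ : ∀ m → fromℕ (suc m) * 1# ≤ fromℕ (Σℕ.∑ X (rounded m))
      total-≥ m = ≤-trans (inj₂ (*-congˡ (≈-sym (total p)))) (∑-scaled-≤ X _ (prob p) (rounded m) (rounded-≥ m))

    approximant : ℕ → 𝒞 X
    approximant m = counting (rounded m) (linear⇒positive {k = λ m → Σℕ.∑ X (rounded m)} 0<1 total-≥ m)

    -- When the probability is zero, the strict bound on the ceiling says that the count is less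
    -- than 1.
    approximant-zero : ∀ m x → prob p x ≈ 0# → count (approximant m) x ≡ 0
    approximant-zero m x px≈0 = ℕₚ.n<1⇒n≡0 (ℕₚ.≰⇒> λ 1≤k → ≤⇒≯ (fromℕ-mono-≤ 1≤k) (begin-strict
      fromℕ (rounded m x)                ≈⟨ +-identityʳ _ ⟨
      fromℕ (rounded m x) + 0#           <⟨ +-monoˡ-< 0# (rounded-< m x) ⟩
      fromℕ (suc m) * prob p x + 1# + 0# ≈⟨ +-congʳ (+-congʳ (*-congˡ px≈0)) ⟩
      fromℕ (suc m) * 0# + 1# + 0#       ≈⟨ solve 1 (λ t → t :* con 0ℤ :+ con 1ℤ :+ con 0ℤ := con 1ℤ :+ con 0ℤ) ≈-refl (fromℕ (suc m)) ⟩
      1# + 0#                            ∎))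

    approximant-marginal-≥ : ∀ {Y} (π : X ⟶ Y) y m →
      fromℕ (suc m) * prob (push-𝒫 π p) y ≤ fromℕ (count (push-𝒞 π (approximant m)) y)
    approximant-marginal-≥ π y m = marginal-scaled-≤ π _ (prob p) (rounded m) y (rounded-≥ m)

    approximant-unbounded : Unbounded (λ m → ∥ approximant m ∥)
    approximant-unbounded = linear⇒unbounded 0<1 total-≥

    approximant-rate : ∀ x → (λ m → fromℕ (count (approximant m) x) / fromℕ (suc m)) ⇝ prob p x
    approximant-rate x = ⇝-squeeze (⇝-const (prob p x))
      (⇝-cong (λ _ → ≈-refl) (+-identityʳ _) (⇝-+ (⇝-const (prob p x)) reciprocal⇝0))
      (λ m → *-cancelˡ-≤ (fromℕ (suc m)) (fromℕ-suc-positive m)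
        (≤-trans (rounded-≥ m x) (inj₂ (≈-sym (cancel m)))))
      (λ m → *-cancelˡ-≤ (fromℕ (suc m)) (fromℕ-suc-positive m) (begin
        fromℕ (suc m) * (fromℕ (rounded m x) / fromℕ (suc m))         ≈⟨ cancel m ⟩
        fromℕ (rounded m x)                                           ≤⟨ inj₁ (rounded-< m x) ⟩
        fromℕ (suc m) * prob p x + 1#                                 ≈⟨ +-congˡ (reciprocal-inverse m) ⟨
        fromℕ (suc m) * prob p x + fromℕ (suc m) * reciprocal m       ≈⟨ distribˡ _ _ _ ⟨
        fromℕ (suc m) * (prob p x + reciprocal m)                     ∎))
      where
      cancel : ∀ m → fromℕ (suc m) * (fromℕ (rounded m x) / fromℕ (suc m)) ≈ fromℕ (rounded m x)
      cancel m = ≈-trans (*-comm _ _) (/-cancel _ (fromℕ-suc-positive m))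

    approximant-↝ : approximant ↝ p
    approximant-↝ x = ⇝-cong (λ _ → ≈-refl) (x/1≈x (prob p x))
      (ratio-⇝ (λ m → ∥∥-positive (approximant m)) fromℕ-suc-positive 0<1 (approximant-rate x)
        (⇝-cong (λ _ → ≈-refl) (total p) (∑-ratio-⇝ X rounded (λ m → fromℕ (suc m)) (prob p) approximant-rate)))

    marginal-vanishes : ∀ {Y} (π : X ⟶ Y) {y} → prob (push-𝒫 π p) y ≈ 0# →
                        ∀ m → count (push-𝒞 π (approximant m)) y ≡ 0
    marginal-vanishes π {y} s≈0 m = marginal-zero π _ y λ { x ≡.refl → approximant-zero m x
      (≤-antisym (≤-trans (prob≤marginal π p x) (inj₂ s≈0)) (nonnegative p x)) }

    module _ {Y} (π : X ⟶ Y) {y} (s≉0 : ¬ prob (push-𝒫 π p) y ≈ 0#) where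
      private
        0<s : 0# < prob (push-𝒫 π p) y
        0<s = ≤∧≉⇒< (nonnegative (push-𝒫 π p) y) (λ 0≈s → s≉0 (≈-sym 0≈s))

      -- The fibre has mass at least (m + 1) Y_*p(y). Positivity for every m, and not just
      -- eventually, is what lets `conditional` be a sequence of counting functions.
      marginal-survives : ∀ m → count (push-𝒞 π (approximant m)) y ≢ 0
      marginal-survives m = ℕₚ.m<n⇒n≢0 (linear⇒positive {k = λ m → count (push-𝒞 π (approximant m)) y} 0<s (approximant-marginal-≥ π y) m)

      conditional : ℕ → 𝒞 X
      conditional m = condition-𝒞 π (approximant m) y (marginal-survives m)

      conditional-unbounded : Unbounded (λ m → ∥ conditional m ∥)
      conditional-unbounded = linear⇒unbounded 0<s (approximant-marginal-≥ π y)

      conditional-↝ : ∀ {q} → IsConditional π p y q → conditional ↝ q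
      conditional-↝ isConditional x = ⇝-cong (λ _ → ≈-refl)
        (*-cancelˡ-≈ _ 0<s (≈-trans (*-comm _ _) (≈-trans (/-cancel _ 0<s)
          (≈-trans (≈-sym (isConditional x)) (*-comm _ _)))))
        (ratio-⇝ (λ m → ∥∥-positive (conditional m)) fromℕ-suc-positive 0<s
          (onFibre-ratio-⇝ π rounded (λ m → fromℕ (suc m)) (prob p) y approximant-rate x)
          (marginal-ratio-⇝ π rounded (λ m → fromℕ (suc m)) (prob p) y approximant-rate))

-- Iterated products below an object

module Products (𝐒 : InformationStructure) where
  open InformationStructure 𝐒

  objects : ∀ {X n} → Vec (𝒮 X) n → Vec Ob n
  objects = Vec.map proj₁

  -- The arrow from `X` is carried along because a binary product exists only when its factors have
  -- a common source; `X` plays this part at each stage.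
  productOf : ∀ {X n} (Xs : Vec (𝒮 X) n) → ∃ λ P → IsProductOf (objects Xs) P × X ⟶ P
  productOf []             = 𝟏 , [] , !
  productOf ((_ , π) ∷ Xs) =
    let Q , isProduct , ρ = productOf Xs
        P , prod          = product π ρ
    in P , prod ∷ isProduct , IsProduct.⟨_,_⟩ prod π ρ

  arrow-≡ : ∀ {X Y} {π ρ : X ⟶ Y} → _≡_ {A = 𝒮 X} (Y , π) (Y , ρ)
  arrow-≡ {π = π} {ρ} = ≡.cong (_ ,_) (irrelevant π ρ)

  precompose-⨾ : ∀ {X Y Z n} (π : X ⟶ Y) (ρ : Y ⟶ Z) (Xs : Vec (𝒮 Z) n) →
                 Vec.map (precompose π) (Vec.map (precompose ρ) Xs) ≡ Vec.map (precompose (π ⨾ ρ)) Xs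
  precompose-⨾ π ρ []       = ≡.refl
  precompose-⨾ π ρ (_ ∷ Xs) = ≡.cong₂ _∷_ arrow-≡ (precompose-⨾ π ρ Xs)

  -- An element of `𝒮 X` is determined by its target, arrows being unique. Naturality of `ψ` can
  -- therefore be read as an equation for the original tuple over `X`.
  precompose-factors : ∀ {X P n} (π : X ⟶ P) (Xs : Vec (𝒮 X) n) (isProduct : IsProductOf (objects Xs) P) →
                       Vec.map (precompose π) (factors isProduct) ≡ Xs
  precompose-factors π []       []                 = ≡.refl
  precompose-factors π (_ ∷ Xs) (prod ∷ isProduct) = ≡.cong₂ _∷_ arrow-≡
    (≡.trans (precompose-⨾ π (IsProduct.π₂ prod) (factors isProduct))
             (precompose-factors (π ⨾ IsProduct.π₂ prod) Xs isProduct))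

-- Measurability of pullbacks along marginalisation

module Measurability (em : ExcludedMiddle 0ℓ) (𝐑 : CompleteOrderedField) (𝐒 : InformationStructure) where
  open Cohomology em 𝐑 𝐒
  open Approximation em 𝐑 𝐒

  -- Preimages commute with complements and unions, so only open sets need an argument: marginals
  -- are finite sums, hence continuous.
  push-borel : ∀ {X Y} (π : X ⟶ Y) {U : Pred (𝒫 Y) 0ℓ} → IsBorel-𝒫 Y U → IsBorel-𝒫 X (U ∘ push-𝒫 π)
  push-borel {X} π (Borel.isOpen open-U) = Borel.isOpen λ p Up →
    let ε , 0<ε , near = open-U (push-𝒫 π p) Up
        δ , 0<δ , close = Close-sum (proj₁ (finite X)) 0<ε
    in δ , 0<δ , λ q p≈q → near (push-𝒫 π q) λ y → close λ i →
       onFibre-lift π (Close δ) y (x<x+ε 0# 0<δ , x<x+ε 0# 0<δ) p≈q (Σℝ.enumerate X i)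
    where open OrderedField em 𝐑 using (x<x+ε)
  push-borel π (Borel.complement b)          = Borel.complement (push-borel π b)
  push-borel π (Borel.union b)               = Borel.union λ i → push-borel π (b i)
  push-borel π (Borel.resp (U⊆V , V⊆U) b)    = Borel.resp (U⊆V , V⊆U) (push-borel π b)

  push-measurable : ∀ {X Y} (π : X ⟶ Y) {f} → IsMeasurable Y f → IsMeasurable X (f ∘ push-𝒫 π)
  push-measurable π f-measurable = record
    { cong       = λ p≈q → IsMeasurable.cong f-measurable λ y → marginal-cong π y p≈q
    ; measurable = λ b → push-borel π (IsMeasurable.measurable f-measurable b)
    }

-- Asymptotic rates of functions of counts

module Rates (em : ExcludedMiddle 0ℓ) (𝐑 : CompleteOrderedField) (𝐒 : InformationStructure)
             (α : CompleteOrderedField.ℝ 𝐑) where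
  open Cohomology em 𝐑 𝐒
  open OrderedField em 𝐑
  open Limits em 𝐑
  open ExponentialFunction em 𝐑 using (module Logarithm)
  open Exponential em 𝐑 using (isExponential; exp-ln)
  open Logarithm isExponential exp-ln using (^ᴿ-positive; ^ᴿ-*; ⇝-^ᴿ)
  open Asymptotics em 𝐑
  open AsymptoticCalculus isExponential
  open Approximation em 𝐑 𝐒
  open MonoidSum +-commutativeMonoid using (sum)
  open MonoidSum (AbelianGroup.commutativeMonoid ℝ₊*) using () renaming (sum to ∏)

  scale : ∀ {X} → (ℕ → 𝒞 X) → ℕ → ℝ
  scale ν m = fromℕ ∥ ν m ∥ ^ᴿ α

  scale-positive : ∀ {X} (ν : ℕ → 𝒞 X) m → 0# < scale ν m
  scale-positive ν m = ^ᴿ-positive (fromℕ ∥ ν m ∥) α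

  -- The hypothesis relating `ψ` and `φ` at a single `p`, with the error term absorbed into a
  -- convergent exponent. Since it covers all sequences, it may be applied to pushed and to
  -- conditioned ones.
  HasRate : ∀ {X} → (𝒞 X → ∃ (0# <_)) → 𝒫 X → ℝ → Set
  HasRate {X} g p l = ∀ (ν : ℕ → 𝒞 X) → Unbounded (λ m → ∥ ν m ∥) → ν ↝ p →
                      (λ m → proj₁ (g (ν m))) ~[ scale ν ] l

  rate-unique : ∀ {X} {g : 𝒞 X → ∃ (0# <_)} {p l k} → HasRate g p l → HasRate g p k → l ≈ k
  rate-unique {p = p} rate rate′ = asymptotic-unique (scale-positive approximant)
    (rate approximant approximant-unbounded approximant-↝)
    (rate′ approximant approximant-unbounded approximant-↝)
    where open Approximant p

  -- Marginalisation preserves the total mass, hence the scale, and it carries convergence to `p` to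
  -- convergence to its marginal.
  rate-push : ∀ {X Y} (π : X ⟶ Y) {g : 𝒞 Y → ∃ (0# <_)} {h : 𝒞 X → ∃ (0# <_)} {p l} →
              (∀ ν → proj₁ (h ν) ≈ proj₁ (g (push-𝒞 π ν))) → HasRate g (push-𝒫 π p) l → HasRate h p l
  rate-push π {p = p} h≈g rate ν unbounded ν↝p = asymptotic-cong
    (λ m → reflexive (≡.cong (λ k → fromℕ k ^ᴿ α) (push-∥∥ π (ν m))))
    (λ m → ≈-sym (h≈g (ν m)))
    (rate (push-𝒞 π ∘ ν)
      (λ K → let N , K≤ = unbounded K in N , λ m N≤m →
        ℕₚ.≤-trans (K≤ m N≤m) (ℕₚ.≤-reflexive (≡.sym (push-∥∥ π (ν m)))))
      (push-↝ π ν p ν↝p))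

  signed-rate : ∀ {g l} k (a : ℕ → ∃ (0# <_)) → (λ m → proj₁ (a m)) ~[ g ] l →
                (λ m → proj₁ (Coefficients.signed 𝒢 k (a m))) ~[ g ] Coefficients.signed (ℱ α) k l
  signed-rate zero    a a~l = a~l
  signed-rate (suc k) a a~l = asymptotic-⁻¹ (signed-rate k a a~l)

  module _ {X Y} (π : X ⟶ Y) (g : 𝒞 X → ∃ (0# <_)) (f : 𝒫 X → ℝ) where
    private
      -- Names the summands of act-𝒢 and act-ℱ, so that a case distinction can be made inside them.
      factor : ∀ ν → ∃ λ (t : Fin (proj₁ (finite Y)) → ∃ (0# <_)) → act-𝒢 π g ν ≡ ∏ t
      factor ν = _ , ≡.refl

      summand : ∀ p → ∃ λ (t : Fin (proj₁ (finite Y)) → ℝ) → act-ℱ α π f p ≡ sum t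
      summand p = _ , ≡.refl

      factor-zero : ∀ ν i → count (push-𝒞 π ν) (Πℝ.enumerate Y i) ≡ 0 → 1# ≈ proj₁ (proj₁ (factor ν) i)
      factor-zero ν i ≡0 with count (push-𝒞 π ν) (Πℝ.enumerate Y i) ℕₚ.≟ 0
      ... | yes _  = ≈-refl
      ... | no  ≢0 = contradiction ≡0 ≢0

      factor-nonzero : ∀ ν i (≢0 : count (push-𝒞 π ν) (Πℝ.enumerate Y i) ≢ 0) →
                       proj₁ (g (condition-𝒞 π ν (Πℝ.enumerate Y i) ≢0)) ≈ proj₁ (proj₁ (factor ν) i)
      factor-nonzero ν i ≢0 with count (push-𝒞 π ν) (Πℝ.enumerate Y i) ℕₚ.≟ 0
      ... | yes ≡0 = contradiction ≡0 ≢0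
      ... | no  _  = ≈-refl

      -- `R` will be the asymptotic statement for the matching factor; keeping it abstract confines
      -- the case distinction to the summand.
      summand-cases : ∀ p i (R : ℝ → Set) → let y = Πℝ.enumerate Y i; s = prob (push-𝒫 π p) y in
                      (s ≈ 0# → R 0#) →
                      (¬ s ≈ 0# → ∀ q → IsConditional π p y q → R (s ^ᴿ α * f q)) →
                      R (proj₁ (summand p) i)
      summand-cases p i R zero-case nonzero-case with prob (push-𝒫 π p) (Πℝ.enumerate Y i) ≟ 0#
      ... | yes s≈0 = zero-case s≈0
      ... | no  s≉0 = nonzero-case s≉0 _ (condition-isConditional π p (Πℝ.enumerate Y i) s≉0)

    -- The claim concerns the approximants only, for which factors and summands vanish together.
    -- This is enough, since one sequence already determines the limit.
    act-rate : (∀ p → HasRate g p (f p)) → ∀ p → let open Approximant p in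
               (λ m → proj₁ (act-𝒢 π g (approximant m))) ~[ scale approximant ] act-ℱ α π f p
    act-rate rate p =
      asymptotic-product {g = scale approximant} {λ i m → proj₁ (factor (approximant m)) i} {proj₁ (summand p)}
        λ i → summand-cases p i (λ l → (λ m → proj₁ (proj₁ (factor (approximant m)) i)) ~[ scale approximant ] l) (vanishing i) (surviving i)
      where
      open Approximant p
      vanishing : ∀ i → prob (push-𝒫 π p) (Πℝ.enumerate Y i) ≈ 0# →
                  (λ m → proj₁ (proj₁ (factor (approximant m)) i)) ~[ scale approximant ] 0#
      vanishing i s≈0 = asymptotic-cong (λ _ → ≈-refl)
        (λ m → factor-zero (approximant m) i (marginal-vanishes π s≈0 m)) asymptotic-1
      surviving : ∀ i (s≉0 : ¬ prob (push-𝒫 π p) (Πℝ.enumerate Y i) ≈ 0#) →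
                  ∀ q → IsConditional π p (Πℝ.enumerate Y i) q →
                  (λ m → proj₁ (proj₁ (factor (approximant m)) i)) ~[ scale approximant ]
                  prob (push-𝒫 π p) (Πℝ.enumerate Y i) ^ᴿ α * f q
      surviving i s≉0 q q-conditional = asymptotic-cong (λ _ → ≈-refl)
        (λ m → factor-nonzero (approximant m) i (marginal-survives π s≉0 m))
        -- The mass `M m` of the conditioned counts is the count of `y` after pushing forward, so
        -- `M m / N m` is the frequency of `y` and tends to Y_*p(y). Taking for `N m` the pushed
        -- mass makes `push-↝` apply as it stands.
        (asymptotic-rescale rescale (⇝-^ᴿ α ratio-positive 0<s (push-↝ π approximant p approximant-↝ y))
          (rate q (conditional π s≉0) (conditional-unbounded π s≉0) (conditional-↝ π s≉0 {q} q-conditional)))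
        where
        y = Πℝ.enumerate Y i
        M N : ℕ → ℝ
        M m = fromℕ ∥ conditional π s≉0 m ∥
        N m = fromℕ ∥ push-𝒞 π (approximant m) ∥
        0<s = ≤∧≉⇒< (nonnegative (push-𝒫 π p) y) (λ 0≈s → s≉0 (≈-sym 0≈s))
        N-positive : ∀ m → 0# < N m
        N-positive m = ∥∥-positive (push-𝒞 π (approximant m))
        ratio-positive : ∀ m → 0# < M m / N m
        ratio-positive m = *-positive (∥∥-positive (conditional π s≉0 m)) (⁻¹-positive (N-positive m))
        rescale : ∀ m → M m ^ᴿ α ≈ scale approximant m * ((M m / N m) ^ᴿ α)
        rescale m = ≈-trans
          (≈-sym (^ᴿ-* α (N-positive m) (ratio-positive m) (≈-trans (*-comm _ _) (/-cancel (M m) (N-positive m)))))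
          (*-congʳ (reflexive (≡.cong (λ k → fromℕ k ^ᴿ α) (push-∥∥ π (approximant m)))))

-- The limit cochain and its cocycle identity

module LimitCochain (em : ExcludedMiddle 0ℓ) (𝐑 : CompleteOrderedField) (𝐒 : InformationStructure)
                    (α : CompleteOrderedField.ℝ 𝐑) where
  open Cohomology em 𝐑 𝐒
  open OrderedField em 𝐑
  open Exponential em 𝐑 using (isExponential)
  open Asymptotics em 𝐑
  open AsymptoticCalculus isExponential
  open Approximation em 𝐑 𝐒
  open Measurability em 𝐑 𝐒
  open Rates em 𝐑 𝐒 α
  open Products 𝐒

  module _
    {n : ℕ} (ψ : Cochain 𝒢 n)
    (φ : ∀ (Xs : Vec Ob n) {P} → IsProductOf Xs P → 𝒫 P → ℝ)
    (φ-measurable : ∀ (Xs : Vec Ob n) {P} (prod : IsProductOf Xs P) → IsMeasurable P (φ Xs prod))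
    (φ-rate : ∀ (Xs : Vec Ob n) {P} (prod : IsProductOf Xs P) p →
              HasRate (Cochain.reduced ψ prod) p (φ Xs prod p))
    where
    open Cochain ψ

    -- This depends a priori on the product chosen by `productOf`; that the choice is immaterial is
    -- proved through rates.
    value : ∀ {X} → Vec (𝒮 X) n → 𝒫 X → ℝ
    value Xs p = let _ , isProduct , π = productOf Xs in φ (objects Xs) isProduct (push-𝒫 π p)

    -- By naturality of `ψ`, its component at `X` is the pullback of the reduced one along
    -- `X ⟶ X₁⋯Xₙ`. Naturality of `Φ`, its reduced form and the cocycle identity all follow from
    -- this description.
    value-rate : ∀ {X} (Xs : Vec (𝒮 X) n) p → HasRate ⟦ Xs ⟧ p (value Xs p)
    value-rate {X} Xs p = rate-push π {g = reduced isProduct} {h = ⟦ Xs ⟧} {p = p}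
      (λ ν → ≡.subst (λ Ys → proj₁ (⟦ Ys ⟧ ν) ≈ proj₁ (reduced isProduct (push-𝒞 π ν)))
        (precompose-factors π Xs isProduct) (natural π (factors isProduct) ν))
      (φ-rate (objects Xs) isProduct (push-𝒫 π p))
      where
      isProduct = proj₁ (proj₂ (productOf Xs))
      π = proj₂ (proj₂ (productOf Xs))

    Φ : Cochain (ℱ α) n
    Φ = record
      { ⟦_⟧     = value
      ; element = λ Xs → let _ , isProduct , π = productOf Xs in
                         push-measurable π (φ-measurable (objects Xs) isProduct)
      ; natural = λ π Xs p → rate-unique {g = ⟦ Vec.map (precompose π) Xs ⟧} {p = p}
          (value-rate (Vec.map (precompose π) Xs) p)
          (rate-push π {g = ⟦ Xs ⟧} {h = ⟦ Vec.map (precompose π) Xs ⟧} {p = p}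
            (natural π Xs) (value-rate Xs (push-𝒫 π p)))
      }

    Φ-reduced : ∀ (Xs : Vec Ob n) {P} (prod : IsProductOf Xs P) p → Cochain.reduced Φ prod p ≈ φ Xs prod p
    Φ-reduced Xs prod p = rate-unique {g = reduced prod} {p = p} (value-rate (factors prod) p) (φ-rate Xs prod p)

    -- The multiplicative coboundary of `ψ` at the approximants has the additive coboundary of `Φ`
    -- as its rate. Being identically 1, it also has rate zero.
    Φ-cocycle : IsCocycle ψ → IsCocycle Φ
    Φ-cocycle ψ-cocycle {X} Xs p = asymptotic-unique (scale-positive approximant) cochain-rate
      (asymptotic-cong (λ _ → ≈-refl) (λ m → ≈-sym (ψ-cocycle Xs (approximant m))) asymptotic-1)
      where
      open Approximant p
      rate : ∀ (Ys : Vec (𝒮 X) n) → (λ m → proj₁ (⟦ Ys ⟧ (approximant m))) ~[ scale approximant ] value Ys p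
      rate Ys = value-rate Ys p approximant approximant-unbounded approximant-↝
      head = proj₂ (Vec.head Xs)
      cochain-rate = asymptotic-*
        (asymptotic-*
          (act-rate head ⟦ Vec.tail Xs ⟧ (value (Vec.tail Xs)) (value-rate (Vec.tail Xs)) p)
          (asymptotic-product {a = λ k m → Coefficients.signed 𝒢 (suc (toℕ k)) (⟦ merge k Xs ⟧ (approximant m))}
            λ k → signed-rate (suc (toℕ k)) (λ m → ⟦ merge k Xs ⟧ (approximant m)) (rate (merge k Xs))))
        (signed-rate (suc n) (λ m → ⟦ Vec.init Xs ⟧ (approximant m)) (rate (Vec.init Xs)))

proposition7 : (em : ExcludedMiddle 0ℓ) (𝐑 : CompleteOrderedField) (𝐒 : InformationStructure) →
    let open Cohomology em 𝐑 𝐒 in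
    (α : ℝ) → 0# < α →
    (n : ℕ) →
    (ψ : Cochain 𝒢 n) → IsCocycle ψ →
    (φ : ∀ (Xs : Vec Ob n) {P} → IsProductOf Xs P → 𝒫 P → ℝ) →
    (∀ (Xs : Vec Ob n) {P} (prod : IsProductOf Xs P) →
    IsMeasurable P (φ Xs prod) ×
    (∀ (p : 𝒫 P) (ν : ℕ → 𝒞 P) →
    (∀ K → ∃ λ N → ∀ m → N ℕ.≤ m → K ℕ.≤ ∥ ν m ∥) →
    (∀ z → (λ m → fromℕ (count (ν m) z) / fromℕ ∥ ν m ∥) ⇝ prob p z) →
    ∃ λ (r : ℕ → ℝ) →
    r ∈o (λ m → fromℕ ∥ ν m ∥ ^ᴿ α) ×
    (∀ m → proj₁ (Cochain.reduced ψ prod (ν m)) ≈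
    exp (fromℕ ∥ ν m ∥ ^ᴿ α * φ Xs prod p + r m)))) →
    IsProbabilisticCocycle α n φ
proposition7 em 𝐑 𝐒 α _ n ψ ψ-cocycle φ hypothesis =
  Φ ψ φ measurable rate , Φ-cocycle ψ φ measurable rate ψ-cocycle , Φ-reduced ψ φ measurable rate
  where
  open Cohomology em 𝐑 𝐒
  open Rates em 𝐑 𝐒 α using (HasRate; scale-positive)
  open Asymptotics em 𝐑
  open AsymptoticCalculus (Exponential.isExponential em 𝐑) using (asymptotic-o)
  open LimitCochain em 𝐑 𝐒 α
  measurable : ∀ (Xs : Vec Ob n) {P} (prod : IsProductOf Xs P) → IsMeasurable P (φ Xs prod)
  measurable Xs prod = proj₁ (hypothesis Xs prod)
  rate : ∀ (Xs : Vec Ob n) {P} (prod : IsProductOf Xs P) p → HasRate (Cochain.reduced ψ prod) p (φ Xs prod p)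
  rate Xs prod p ν unbounded ν↝p =
    let _ , r∈o , ψ≈ = proj₂ (hypothesis Xs prod) p ν unbounded ν↝p
    in asymptotic-o (scale-positive ν) r∈o ψ≈
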